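{- Let $G$ be a finite graph and let $k$ and $\ell$ be the Wollan's tree-cut width and the ab-tree-cut width of $G$, respectively. Then $\frac{k}{2}-1\leq \ell\leq k^2$.
   Context: Graphs are finite and undirected; parallel edges are allowed, loops are not. A near-partition of a set $\Omega$ is a family of pairwise disjoint (possibly empty) subsets of $\Omega$ with union $\Omega$. A tree-cut decomposition of $G$ is a pair $\mathcal{T}=(T,\mathcal{X})$ where $T$ is a tree and $\mathcal{X}=\{X_t : t\in V(T)\}$ is a near-partition of $V(G)$ indexed by the nodes of $T$; $X_t$ is the bag of $t$. For an edge $st$ of $T$, $\mathrm{adh}(st)$ is the set of edges $uv$ of $G$ such that the node whose bag contains $u$ and the node whose bag contains $v$ lie in different components of $T-st$. The edge $st$ is bold if $|\mathrm{adh}(st)|\geq 3$ and thin otherwise. ab-tree-cut width. For a node $t$, $\mathrm{adh}(t)$ is the union of the sets $\mathrm{adh}(st)$ over all bold edges $st$ of $T$ incident to $t$. The adhesion-width of $\mathcal{T}$ is $\max_{t\in V(T)}|\mathrm{adh}(t)|$ and the bag-width of $\mathcal{T}$ is $\max_{t\in V(T)}|X_t|$. The ab-tree-cut width of $G$ is the least number $\ell$ such that $G$ has a tree-cut decomposition with adhesion-width $\leq \ell$ and bag-width $\leq \ell$. Wollan's tree-cut width. The trace of a pair of vertices $u,v$ of $G$ in $\mathcal{T}$ is the path in $T$ between the node whose bag contains $u$ and the node whose bag contains $v$ (a single node if these coincide). For a node $t$ of $T$, define the equivalence relation $\sim_t$ on $V(G)$ by: $u\sim_t v$ if $u=v$,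 or $u\neq v$ and the trace of $\{u,v\}$ does not contain $t$. The torso $G_t$ is the quotient graph of $G$ by $\sim_t$: its vertices are the equivalence classes of $\sim_t$, and each edge $uv$ of $G$ with $u\not\sim_t v$ gives rise to one edge of $G_t$ between the classes of $u$ and $v$ (so parallel edges are kept, and edges inside a class are discarded); vertices of $X_t$ form singleton classes and are regarded as vertices of $G_t$. The 3-center $\widetilde{G}_t$ is obtained from $G_t$ by iteratively suppressing vertices of degree at most 2 that do not belong to $X_t$, where suppressing a vertex of degree at most 2 means deleting it if it has at most one neighbor, and deleting it and adding an edge between its two former neighbors if it has exactly two neighbors (the order of suppressions does not matter; degrees count parallel edges). The Wollan's width of $\mathcal{T}$ is $\max\left(\{|\mathrm{adh}(e)| : e\in E(T)\}\cup\{|V(\widetilde{G}_t)| : t\in V(T)\}\right)$, and the Wollan's tree-cut width of $G$ is the minimum Wollan's width of a tree-cut decomposition of $G$. -}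

module Defs where

open import Data.Bool.Properties using () renaming (_≟_ to _≟ᵇ_)
open import Data.Fin.Base using (Fin)
open import Data.Fin.Properties using (any?) renaming (_≟_ to _≟ᶠ_)
open import Data.Fin.Subset using (Subset; _∈_; _∩_; Empty; ⋃; ∣_∣)
open import Data.Fin.Subset.Properties using (_∈?_)
open import Data.List.Base using (List; []; _∷_; length; map; filter; allFin; deduplicate)
open import Data.List.Extrema.Nat using (max)
open import Data.List.Membership.Propositional using () renaming (_∈_ to _∈ₗ_)
open import Data.List.Membership.Propositional.Properties using (∈-allFin; ∈-filter⁺; ∈-filter⁻)
open import Data.List.Relation.Unary.Any as Any using (Any; here; there)
open import Data.List.Relation.Unary.Unique.Propositional using (Unique)
import Data.List.Membership.DecPropositional as DecMembership
open import Data.Nat.Base using (ℕ; zero; suc; _≤_; _⊔_)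
open import Data.Nat.Properties using (_≤?_)
open import Data.Product.Base using (Σ; ∃; _×_; _,_; proj₁; proj₂)
open import Data.Product.Properties using () renaming (≡-dec to ×-≡-dec)
open import Data.Sum.Base using (_⊎_; inj₁; inj₂)
open import Data.Vec.Base using (tabulate)
open import Data.Vec.Properties using () renaming (≡-dec to Vec-≡-dec)
open import Function.Base using (_∘_; id)
open import Relation.Binary.Construct.Closure.ReflexiveTransitive using (Star; ε; _◅_; _◅◅_; gmap)
open import Relation.Binary.Definitions using (DecidableEquality)
open import Relation.Binary.PropositionalEquality using (_≡_; _≢_; refl)
open import Relation.Nullary using (¬_; Dec; does; yes; no)
open import Relation.Nullary.Decidable using (¬?; _×-dec_; _⊎-dec_; map′)

-- Unordered pairs are represented by ordered ones; everything below is
-- insensitive to the orientation.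

Joins : {A : Set} → A × A → A → A → Set
Joins p x y = (p ≡ (x , y)) ⊎ (p ≡ (y , x))

Incident : {A : Set} → A → A × A → Set
Incident x p = (x ≡ proj₁ p) ⊎ (x ≡ proj₂ p)

module _ {A : Set} (_≟_ : DecidableEquality A) where

  joins? : (p : A × A) (x y : A) → Dec (Joins p x y)
  joins? p x y = ×-≡-dec _≟_ _≟_ p (x , y) ⊎-dec ×-≡-dec _≟_ _≟_ p (y , x)

  incident? : (x : A) (p : A × A) → Dec (Incident x p)
  incident? x p = (x ≟ proj₁ p) ⊎-dec (x ≟ proj₂ p)

comprehension : ∀ {n} {P : Fin n → Set} → (∀ i → Dec (P i)) → Subset n
comprehension P? = tabulate (does ∘ P?)

maxOver : (n : ℕ) → (Fin n → ℕ) → ℕ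
maxOver n f = max 0 (map f (allFin n))

record Graph : Set where
  field
    order    : ℕ
    size     : ℕ
    ends     : Fin size → Fin order × Fin order
    loopless : ∀ e → proj₁ (ends e) ≢ proj₂ (ends e)

  Vertex Edge : Set
  Vertex = Fin order
  Edge   = Fin size

  data Walk : Vertex → Vertex → Set where
    []   : ∀ {x} → Walk x x
    step : ∀ {x y z} (e : Edge) → Joins (ends e) x y → Walk y z → Walk x z

  vertices : ∀ {x y} → Walk x y → List Vertex
  vertices {x} []           = x ∷ []
  vertices {x} (step _ _ w) = x ∷ vertices w

  edges : ∀ {x y} → Walk x y → List Edge
  edges []           = []
  edges (step e _ w) = e ∷ edges w

  Path : Vertex → Vertex → Set
  Path x y = Σ (Walk x y) (Unique ∘ vertices)

  -- A path together with an edge outside it that joins its two ends; two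
  -- parallel edges form a cycle.
  Cycle : Set
  Cycle = ∃ λ x → ∃ λ y → Σ (Path x y) λ p →
          ∃ λ e → Joins (ends e) x y × ¬ (e ∈ₗ edges (proj₁ p))

  -- x and y lie in the same component of the graph minus the edge e.
  Connected∖ : Edge → Vertex → Vertex → Set
  Connected∖ e = Star (λ x y → ∃ λ f → f ≢ e × Joins (ends f) x y)

  connected∖? : ∀ e x y → Dec (Connected∖ e x y)
  connected∖? e x y = map′ (gmap id to) (gmap id from) (linked? others x y)
    where
    Linked : List Edge → Vertex → Vertex → Set
    Linked es = Star (λ x y → ∃ λ f → f ∈ₗ es × Joins (ends f) x y)

    Via : Edge → List Edge → Vertex → Vertex → Set
    Via f es x y = Linked es x y
      ⊎ ((Linked es x (proj₁ (ends f)) × Linked es (proj₂ (ends f)) y)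
      ⊎  (Linked es x (proj₂ (ends f)) × Linked es (proj₁ (ends f)) y))

    weaken : ∀ {f es x y} → Linked es x y → Linked (f ∷ es) x y
    weaken = gmap id (λ { (g , g∈ , j) → g , there g∈ , j })

    via⇒linked : ∀ {f es x y} → Via f es x y → Linked (f ∷ es) x y
    via⇒linked (inj₁ w) = weaken w
    via⇒linked {f} (inj₂ (inj₁ (v , w))) =
      weaken v ◅◅ ((f , here refl , inj₁ refl) ◅ weaken w)
    via⇒linked {f} (inj₂ (inj₂ (v , w))) =
      weaken v ◅◅ ((f , here refl , inj₂ refl) ◅ weaken w)

    linked⇒via : ∀ {f es x y} → Linked (f ∷ es) x y → Via f es x y
    linked⇒via ε = inj₁ ε
    linked⇒via ((g , there g∈ , j) ◅ w) with linked⇒via w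
    ... | inj₁ v              = inj₁ ((g , g∈ , j) ◅ v)
    ... | inj₂ (inj₁ (v , u)) = inj₂ (inj₁ ((g , g∈ , j) ◅ v , u))
    ... | inj₂ (inj₂ (v , u)) = inj₂ (inj₂ ((g , g∈ , j) ◅ v , u))
    linked⇒via {f} ((.f , here refl , j) ◅ w) with ends f | j | linked⇒via w
    ... | _ | inj₁ refl | inj₁ v              = inj₂ (inj₁ (ε , v))
    ... | _ | inj₁ refl | inj₂ (inj₁ (_ , u)) = inj₂ (inj₁ (ε , u))
    ... | _ | inj₁ refl | inj₂ (inj₂ (_ , u)) = inj₁ u
    ... | _ | inj₂ refl | inj₁ v              = inj₂ (inj₂ (ε , v))
    ... | _ | inj₂ refl | inj₂ (inj₁ (_ , u)) = inj₁ u
    ... | _ | inj₂ refl | inj₂ (inj₂ (_ , u)) = inj₂ (inj₂ (ε , u))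

    linked? : ∀ es x y → Dec (Linked es x y)
    linked? [] x y = map′ (λ { refl → ε }) (λ { ε → refl ; ((_ , () , _) ◅ _) }) (x ≟ᶠ y)
    linked? (f ∷ es) x y = map′ via⇒linked linked⇒via
      (linked? es x y
        ⊎-dec ((linked? es x (proj₁ (ends f)) ×-dec linked? es (proj₂ (ends f)) y)
        ⊎-dec  (linked? es x (proj₂ (ends f)) ×-dec linked? es (proj₁ (ends f)) y)))

    others : List Edge
    others = filter (λ f → ¬? (f ≟ᶠ e)) (allFin size)

    to : ∀ {x y} → (∃ λ f → f ∈ₗ others × Joins (ends f) x y) → ∃ λ f → f ≢ e × Joins (ends f) x y
    to (f , f∈ , j) = f , proj₂ (∈-filter⁻ (λ f → ¬? (f ≟ᶠ e)) {xs = allFin size} f∈) , j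

    from : ∀ {x y} → (∃ λ f → f ≢ e × Joins (ends f) x y) → ∃ λ f → f ∈ₗ others × Joins (ends f) x y
    from (f , f≢e , j) = f , ∈-filter⁺ (λ f → ¬? (f ≟ᶠ e)) (∈-allFin f) f≢e , j

record IsTree (T : Graph) : Set where
  open Graph T
  field
    nonempty  : Vertex
    connected : ∀ x y → Path x y
    acyclic   : ¬ Cycle

-- Multigraphs whose vertices come from an arbitrary set.  It is only used
-- for torsos and the graphs obtained from them: the vertices are listed
-- without repetition and there are no loops.

record Multigraph (A : Set) : Set where
  constructor multigraph
  field
    vertexList : List A
    edgeList   : List (A × A)

open Multigraph public

module Suppression {A : Set} (_≟_ : DecidableEquality A) where

  degree : Multigraph A → A → ℕ
  degree H x = length (filter (incident? _≟_ x) (edgeList H))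

  neighbours : Multigraph A → A → List A
  neighbours H x =
    filter (λ y → Any.any? (λ p → joins? _≟_ p x y) (edgeList H)) (vertexList H)

  delete : Multigraph A → A → Multigraph A
  delete H x = multigraph (filter (λ y → ¬? (y ≟ x)) (vertexList H))
                          (filter (λ p → ¬? (incident? _≟_ x p)) (edgeList H))

  addEdge : A × A → Multigraph A → Multigraph A
  addEdge p H = multigraph (vertexList H) (p ∷ edgeList H)

  -- Meaningful for degree at most 2, when there are at most two neighbours.
  suppress : Multigraph A → A → Multigraph A
  suppress H x with neighbours H x
  ... | y ∷ z ∷ [] = addEdge (y , z) (delete H x)
  ... | _          = delete H x

  module _ {Protected : A → Set} (protected? : ∀ x → Dec (Protected x)) where

    suppressible : Multigraph A → List A
    suppressible H =
      filter (λ x → (degree H x ≤? 2) ×-dec ¬? (protected? x)) (vertexList H)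

    -- The number bounds the number of rounds; each round removes a vertex.
    suppressWithin : ℕ → Multigraph A → Multigraph A
    suppressWithin zero    H = H
    suppressWithin (suc n) H with suppressible H
    ... | []    = H
    ... | x ∷ _ = suppressWithin n (suppress H x)

    -- Suppresses until no unprotected vertex has degree at most 2.  The result
    -- does not depend, up to isomorphism, on the order of the suppressions;
    -- the first suppressible vertex in the list is always taken.
    suppressAll : Multigraph A → Multigraph A
    suppressAll H = suppressWithin (length (vertexList H)) H

record TreeCutDecomposition (G : Graph) : Set where
  open Graph G using (Vertex; Edge; order; size; ends)
  field
    tree     : Graph
    isTree   : IsTree tree
    bag      : Graph.Vertex tree → Subset order
    disjoint : ∀ s t → s ≢ t → Empty (bag s ∩ bag t)
    covers   : ∀ v → ∃ λ t → v ∈ bag t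

  module T = Graph tree
  open IsTree isTree using (connected)

  nodeOf : Vertex → T.Vertex
  nodeOf v = proj₁ (covers v)

  adh : T.Edge → Subset size
  adh e = comprehension λ f →
    ¬? (T.connected∖? e (nodeOf (proj₁ (ends f))) (nodeOf (proj₂ (ends f))))

  Bold : T.Edge → Set
  Bold e = 3 ≤ ∣ adh e ∣

  bold? : ∀ e → Dec (Bold e)
  bold? e = 3 ≤? ∣ adh e ∣

  adhNode : T.Vertex → Subset size
  adhNode t = ⋃ (map adh (filter (λ e → bold? e ×-dec incident? _≟ᶠ_ t (T.ends e))
                                 (allFin T.size)))

  adhesionWidth : ℕ
  adhesionWidth = maxOver T.order (λ t → ∣ adhNode t ∣)

  bagWidth : ℕ
  bagWidth = maxOver T.order (λ t → ∣ bag t ∣)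

  -- The unique path of the tree between the nodes of u and v, as a list of nodes.
  trace : Vertex → Vertex → List T.Vertex
  trace u v = T.vertices (proj₁ (connected (nodeOf u) (nodeOf v)))

  Equiv : T.Vertex → Vertex → Vertex → Set
  Equiv t u v = (u ≡ v) ⊎ (u ≢ v × ¬ (t ∈ₗ trace u v))

  equiv? : ∀ t u v → Dec (Equiv t u v)
  equiv? t u v = (u ≟ᶠ v) ⊎-dec (¬? (u ≟ᶠ v) ×-dec ¬? (t ∈ₗ? trace u v))
    where open DecMembership _≟ᶠ_ using () renaming (_∈?_ to _∈ₗ?_)

  class : T.Vertex → Vertex → Subset order
  class t v = comprehension (λ u → equiv? t u v)

  _≟ˢ_ : DecidableEquality (Subset order)
  _≟ˢ_ = Vec-≡-dec _≟ᵇ_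

  torso : T.Vertex → Multigraph (Subset order)
  torso t = multigraph
    (deduplicate _≟ˢ_ (map (class t) (allFin order)))
    (map (λ f → class t (proj₁ (ends f)) , class t (proj₂ (ends f)))
         (filter (λ f → ¬? (equiv? t (proj₁ (ends f)) (proj₂ (ends f)))) (allFin size)))

  -- The vertices of the torso that are vertices of the bag of t.
  InBag : T.Vertex → Subset order → Set
  InBag t C = ∃ λ v → v ∈ bag t × C ≡ class t v

  inBag? : ∀ t C → Dec (InBag t C)
  inBag? t C = any? (λ v → (v ∈? bag t) ×-dec (C ≟ˢ class t v))

  threeCenter : T.Vertex → Multigraph (Subset order)
  threeCenter t = Suppression.suppressAll _≟ˢ_ (inBag? t) (torso t)

  wollanWidth : ℕ
  wollanWidth = maxOver T.size (λ e → ∣ adh e ∣)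
              ⊔ maxOver T.order (λ t → length (vertexList (threeCenter t)))

IsLeast : (ℕ → Set) → ℕ → Set
IsLeast P n = P n × (∀ m → P m → n ≤ m)

IsAbTreeCutWidth : Graph → ℕ → Set
IsAbTreeCutWidth G = IsLeast λ ℓ → Σ (TreeCutDecomposition G) λ 𝒯 →
  let open TreeCutDecomposition 𝒯 in adhesionWidth ≤ ℓ × bagWidth ≤ ℓ

IsWollanTreeCutWidth : Graph → ℕ → Set
IsWollanTreeCutWidth G = IsLeast λ k → Σ (TreeCutDecomposition G) λ 𝒯 →
  TreeCutDecomposition.wollanWidth 𝒯 ≡ k

module Submission where

-- For k/2 - 1 ≤ ℓ one keeps the decomposition.  Suppressing never increases a
-- degree, so a vertex of the 3-center at t outside the bag has degree at least
-- 3 in the torso; the tree edge towards it is then bold, and counting the edges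
-- of adh(t) by their ends gives at most ⅔ |adh(t)| such vertices.
--
-- For ℓ ≤ k² suppressing a vertex x of the torso is read as contracting x into
-- a neighbour y.  If neither is in the bag, the tree is changed accordingly: t
-- is split, the branches of x and y being moved to a new node with empty bag.
-- Old adhesions are unchanged, the new one is at most the degree of y, and the
-- new node has at most two bold edges, as x has degree at most 2.  If all
-- neighbours of x are in the bag, the branch of x just stays at t as a thin one.
-- In the end every bold edge at t belongs to a vertex of the 3-center, so each
-- node has at most k bold edges, each with adhesion at most k.

open import Defs
open import Data.Bool.Base using (Bool; true; false; if_then_else_)
open import Data.Bool.Properties using () renaming (_≟_ to _≟ᵇ_)
open import Data.Fin.Base using (Fin; zero; suc)
open import Data.Fin.Properties using (any?; suc-injective) renaming (_≟_ to _≟ᶠ_)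
open import Data.Fin.Subset using (Subset; _∪_; ⋃; ∣_∣)
  renaming (_∈_ to _∈ˢ_; _∉_ to _∉ˢ_; ⊥ to ⊥ˢ)
open import Data.Fin.Subset.Properties
  using (p⊆q⇒∣p∣≤∣q∣; x∈p∩q⁺; x∈p∩q⁻; x∈p∪q⁺; ∉⊥; ∣⊥∣≡0; ⊆-antisym) renaming (_∈?_ to _∈ˢ?_)
open import Data.Integer.Base as ℤ using (+_)
import Data.Integer.Properties as ℤ
open import Data.List.Base as List using (List; []; _∷_; length; map; filter; allFin)
open import Data.List.Extrema.Nat using (xs≤max; max≤v⁺)
import Data.List.Membership.DecPropositional as DecMembership
open import Data.List.Membership.Propositional using (_∈_; _∉_; find; lose)
open import Data.List.Membership.Propositional.Properties
  using (∈-allFin; ∈-filter⁺; ∈-filter⁻; ∈-map⁺; ∈-map⁻; ∈-deduplicate⁺; ∈-deduplicate⁻)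
open import Data.List.Properties using (filter-accept; filter-notAll; filter-reject; length-map)
open import Data.List.Relation.Unary.All as All using (All; []; _∷_)
import Data.List.Relation.Unary.All.Properties as All
open import Data.List.Relation.Unary.AllPairs using ([]; _∷_)
open import Data.List.Relation.Unary.Any as Any using (Any; here; there)
open import Data.List.Relation.Unary.Unique.DecPropositional.Properties using (deduplicate-!)
open import Data.List.Relation.Unary.Unique.Propositional using (Unique)
open import Data.List.Relation.Unary.Unique.Propositional.Properties using (allFin⁺)
  renaming (filter⁺ to unique-filter; map⁺ to unique-map)
open import Data.Nat.Base hiding (_/_)
open import Data.Nat.ListAction using (sum)
open import Data.Nat.Properties hiding (suc-injective)
open import Algebra.Properties.CommutativeSemigroup +-commutativeSemigroup using (x∙yz≈y∙xz)
open import Data.Product.Base using (Σ; ∃; ∃₂; _×_; _,_; proj₁; proj₂)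
open import Data.Rational.Base using (_/_; _-_; 1ℚ; toℚᵘ) renaming (_≤_ to _≤ℚ_; -_ to -ℚ_)
import Data.Rational.Properties as ℚ
open import Data.Rational.Unnormalised.Base as ℚᵘ using (mkℚᵘ; *≤*)
import Data.Rational.Unnormalised.Properties as ℚᵘ
open import Data.Sum.Base using (_⊎_; inj₁; inj₂; [_,_])
open import Data.Unit.Base using (⊤; tt)
import Data.Vec.Base as Vec
open import Data.Vec.Properties using (lookup∘tabulate; []=⇒lookup; lookup⇒[]=)
open import Function.Base using (_∘_; id)
open import Relation.Binary.Construct.Closure.ReflexiveTransitive as Star using (Star; ε; _◅_; _◅◅_)
open import Relation.Binary.Definitions using (DecidableEquality)
open import Relation.Binary.PropositionalEquality hiding ([_])
open import Relation.Nullary using (¬_; Dec; does; yes; no; contradiction)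
open import Relation.Nullary.Decidable using (¬?; dec-true; dec-false; _×-dec_; _⊎-dec_; decidable-stable)
open import Relation.Unary using (Decidable)

-- Counting

-- A split changes the tree and with it the torsos, so the suppressions at `t` are not replayed on
-- the new decompositions. They are run once, on the original torso, and recorded as a sequence of
-- merges of labels of vertices of `G`. This record (`Reducible`) does not mention the tree, so it
-- survives the splits made at other nodes. The record carries no isomorphism with the suppressed
-- multigraph, only inequalities between cuts. An adhesion is the cut of a vertex set of `G`, and
-- suppression does not shrink the relevant cuts, so degrees in the multigraph, which never grow,
-- bound the adhesions. Vertices of the bag are never merged with anything; accordingly only cuts of
-- sets disjoint from the bag are compared. For k < 3 no edge is bold and the decomposition is kept.
-- Otherwise k leaves room for the two bold edges that a new node may have.

count : ∀ {A : Set} {P : A → Set} → Decidable P → List A → ℕ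
count P? xs = length (filter P? xs)

count-mono : ∀ {A : Set} {P Q : A → Set} (P? : Decidable P) (Q? : Decidable Q) (xs : List A) →
             (∀ {x} → x ∈ xs → P x → Q x) → count P? xs ≤ count Q? xs
count-mono P? Q? []       P⇒Q = z≤n
count-mono P? Q? (x ∷ xs) P⇒Q with ih ← count-mono P? Q? xs (P⇒Q ∘ there) | P? x | Q? x
... | yes p | yes q = s≤s ih
... | yes p | no ¬q = contradiction (P⇒Q (here refl) p) ¬q
... | no _  | yes _ = m≤n⇒m≤1+n ih
... | no _  | no _  = ih

count-none : ∀ {A : Set} {P : A → Set} (P? : Decidable P) (xs : List A) →
             (∀ {x} → x ∈ xs → ¬ P x) → count P? xs ≡ 0
count-none P? []       ¬P = refl
count-none P? (x ∷ xs) ¬P with P? x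
... | yes p = contradiction p (¬P (here refl))
... | no _  = count-none P? xs (¬P ∘ there)

count-map : ∀ {A B : Set} {P : A → Set} (P? : Decidable P) (f : B → A) (xs : List B) →
            count P? (map f xs) ≡ count (P? ∘ f) xs
count-map P? f []       = refl
count-map P? f (x ∷ xs) with P? (f x)
... | yes _ = cong suc (count-map P? f xs)
... | no _  = count-map P? f xs

count-filter : ∀ {A : Set} {P Q : A → Set} (P? : Decidable P) (Q? : Decidable Q) (xs : List A) →
               count P? (filter Q? xs) ≡ count (λ x → P? x ×-dec Q? x) xs
count-filter P? Q? []       = refl
count-filter P? Q? (x ∷ xs) with Q? x
... | yes q with P? x
...   | yes p = cong suc (count-filter P? Q? xs)
...   | no ¬p = count-filter P? Q? xs
count-filter P? Q? (x ∷ xs) | no ¬q with P? x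
... | yes p = count-filter P? Q? xs
... | no ¬p = count-filter P? Q? xs

count-split : ∀ {A : Set} {P Q : A → Set} (P? : Decidable P) (Q? : Decidable Q) (xs : List A) →
              count P? xs ≡ count P? (filter Q? xs) + count P? (filter (¬? ∘ Q?) xs)
count-split P? Q? []       = refl
count-split P? Q? (x ∷ xs) with Q? x
... | yes q with P? x
...   | yes p = cong suc (count-split P? Q? xs)
...   | no ¬p = count-split P? Q? xs
count-split P? Q? (x ∷ xs) | no ¬q with P? x
... | yes p = trans (cong suc (count-split P? Q? xs)) (sym (+-suc _ _))
... | no ¬p = count-split P? Q? xs

length-split : {A : Set} {P : A → Set} (P? : Decidable P) (xs : List A) →
               length xs ≡ count P? xs + count (¬? ∘ P?) xs
length-split P? []       = refl
length-split P? (x ∷ xs) with P? x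
... | yes _ = cong suc (length-split P? xs)
... | no _  = trans (cong suc (length-split P? xs)) (sym (+-suc _ _))

-- Stated for a relation, so that no matching has to be constructed: the head claims some `y`, and
-- by injectivity the hits of all other entries differ from `y` and survive its removal from `ys`.
pigeonhole : {A B : Set} (R : A → B → Set) {xs : List A} (ys : List B) → Unique xs →
             (∀ {x} → x ∈ xs → ∃ λ y → y ∈ ys × R x y) →
             (∀ {x x′ y} → x ∈ xs → x′ ∈ xs → R x y → R x′ y → x ≡ x′) →
             length xs ≤ length ys
pigeonhole R {[]}     ys _        _   _   = z≤n
pigeonhole R {x ∷ xs} ys (x∉ ∷ u) hit inj with hit (here refl)
... | y , y∈ , r = ≤-trans (s≤s (pigeonhole R (remove y∈) u hit′ λ a b → inj (there a) (there b)))
                           (≤-reflexive (length-remove y∈))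
  where
  remove : ∀ {y ys} → y ∈ ys → List _
  remove {ys = _ ∷ ys} (here _)  = ys
  remove {ys = z ∷ _}  (there p) = z ∷ remove p

  length-remove : ∀ {y ys} (p : y ∈ ys) → suc (length (remove p)) ≡ length ys
  length-remove (here _)  = refl
  length-remove (there p) = cong suc (length-remove p)

  ∈-remove : ∀ {y z ys} (p : y ∈ ys) → z ∈ ys → z ≢ y → z ∈ remove p
  ∈-remove (here refl) (here refl) z≢y = contradiction refl z≢y
  ∈-remove (here _)    (there q)   z≢y = q
  ∈-remove (there p)   (here e)    z≢y = here e
  ∈-remove (there p)   (there q)   z≢y = there (∈-remove p q z≢y)

  hit′ : ∀ {x′} → x′ ∈ xs → ∃ λ z → z ∈ remove y∈ × R x′ z
  hit′ x′∈ with hit (there x′∈)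
  ... | z , z∈ , r′ = z , ∈-remove y∈ z∈ (λ { refl → All.lookup x∉ x′∈ (inj (here refl) (there x′∈) r r′) }) , r′

module _ {A B : Set} {R : A → B → Set} (R? : ∀ a b → Dec (R a b)) where

  private
    total : List A → List B → ℕ
    total xs ys = sum (map (λ x → count (R? x) ys) xs)

    total-[] : ∀ xs → total xs [] ≡ 0
    total-[] []       = refl
    total-[] (x ∷ xs) = total-[] xs

    total-∷ : ∀ xs y ys → total xs (y ∷ ys) ≡ count (λ x → R? x y) xs + total xs ys
    total-∷ []       y ys = refl
    total-∷ (x ∷ xs) y ys rewrite total-∷ xs y ys with R? x y
    ... | yes _ = cong suc (x∙yz≈y∙xz (count (R? x) ys) (count (λ x → R? x y) xs) _)
    ... | no _  = x∙yz≈y∙xz (count (R? x) ys) (count (λ x → R? x y) xs) _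

    total≤ : ∀ {n} xs ys → (∀ {y} → y ∈ ys → count (λ x → R? x y) xs ≤ n) → total xs ys ≤ length ys * n
    total≤ xs []       ≤n = ≤-reflexive (total-[] xs)
    total≤ xs (y ∷ ys) ≤n = ≤-trans (≤-reflexive (total-∷ xs y ys))
      (+-mono-≤ (≤n (here refl)) (total≤ xs ys (≤n ∘ there)))

    total≥ : ∀ {m} xs ys → (∀ {x} → x ∈ xs → m ≤ count (R? x) ys) → length xs * m ≤ total xs ys
    total≥ []       ys m≤ = z≤n
    total≥ (x ∷ xs) ys m≤ = +-mono-≤ (m≤ (here refl)) (total≥ xs ys (m≤ ∘ there))

  -- `total` adds up the relation row by row, which gives the lower bound; `total-∷` peels off a
  -- column instead, which gives the upper bound.
  double-count : ∀ {m n} xs ys → (∀ {x} → x ∈ xs → m ≤ count (R? x) ys) →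
                 (∀ {y} → y ∈ ys → count (λ x → R? x y) xs ≤ n) → length xs * m ≤ length ys * n
  double-count xs ys m≤ ≤n = ≤-trans (total≥ xs ys m≤) (total≤ xs ys ≤n)

handshake : {A : Set} (_≟_ : DecidableEquality A) {m : ℕ} {xs : List A} (ps : List (A × A)) → Unique xs →
            (∀ {x} → x ∈ xs → m ≤ count (incident? _≟_ x) ps) → length xs * m ≤ length ps * 2
handshake _≟_ {xs = xs} ps u m≤ = double-count (incident? _≟_) xs ps m≤ λ {p} _ →
  -- The column bound: the entries of `xs` incident to `p` are distinct and all occur in the
  -- two-element list of its ends.
  pigeonhole _≡_ (proj₁ p ∷ proj₂ p ∷ []) (unique-filter (λ x → incident? _≟_ x p) u)
    (λ x∈ → end (proj₂ (∈-filter⁻ (λ x → incident? _≟_ x p) {xs = xs} x∈))) λ { _ _ refl refl → refl }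
  where
  end : ∀ {p x} → Incident x p → ∃ λ y → y ∈ proj₁ p ∷ proj₂ p ∷ [] × x ≡ y
  end (inj₁ refl) = _ , here refl , refl
  end (inj₂ refl) = _ , there (here refl) , refl

∈-comprehension⁺ : ∀ {n} {P : Fin n → Set} (P? : Decidable P) {i} → P i → i ∈ˢ comprehension P?
∈-comprehension⁺ P? {i} p =
  lookup⇒[]= i _ (trans (lookup∘tabulate (does ∘ P?) i) (dec-true (P? i) p))

∈-comprehension⁻ : ∀ {n} {P : Fin n → Set} (P? : Decidable P) {i} → i ∈ˢ comprehension P? → P i
∈-comprehension⁻ P? {i} i∈ with P? i | trans (sym (lookup∘tabulate (does ∘ P?) i)) ([]=⇒lookup i∈)
... | yes p | _ = p
... | no _  | ()

∣comprehension∣ : ∀ {n} {P : Fin n → Set} (P? : Decidable P) →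
                  ∣ comprehension P? ∣ ≡ count P? (allFin n)
∣comprehension∣ P? = helper id P?
  where
  -- `f` is arbitrary because the tail of `allFin` tabulates `suc` and no longer the identity.
  helper : ∀ {n} {A : Set} {P : A → Set} (f : Fin n → A) (P? : Decidable P) →
           ∣ Vec.tabulate (does ∘ P? ∘ f) ∣ ≡ count P? (List.tabulate f)
  helper {zero}  f P? = refl
  helper {suc n} f P? with P? (f zero)
  ... | yes _ = cong suc (helper (f ∘ suc) P?)
  ... | no _  = helper (f ∘ suc) P?

∣∣≡length : ∀ {n} (p : Subset n) → ∣ p ∣ ≡ length (filter (_∈ˢ? p) (allFin n))
∣∣≡length p = trans
  (cong ∣_∣ (⊆-antisym (∈-comprehension⁺ (_∈ˢ? p)) (∈-comprehension⁻ (_∈ˢ? p))))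
  (∣comprehension∣ (_∈ˢ? p))

∣p∪q∣≤∣p∣+∣q∣ : ∀ {n} (p q : Subset n) → ∣ p ∪ q ∣ ≤ ∣ p ∣ + ∣ q ∣
∣p∪q∣≤∣p∣+∣q∣ Vec.[]            Vec.[]            = z≤n
∣p∪q∣≤∣p∣+∣q∣ (true  Vec.∷ p) (true  Vec.∷ q) =
  s≤s (≤-trans (∣p∪q∣≤∣p∣+∣q∣ p q) (+-monoʳ-≤ ∣ p ∣ (n≤1+n ∣ q ∣)))
∣p∪q∣≤∣p∣+∣q∣ (true  Vec.∷ p) (false Vec.∷ q) = s≤s (∣p∪q∣≤∣p∣+∣q∣ p q)
∣p∪q∣≤∣p∣+∣q∣ (false Vec.∷ p) (true  Vec.∷ q) =
  ≤-trans (s≤s (∣p∪q∣≤∣p∣+∣q∣ p q)) (≤-reflexive (sym (+-suc ∣ p ∣ ∣ q ∣)))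
∣p∪q∣≤∣p∣+∣q∣ (false Vec.∷ p) (false Vec.∷ q) = ∣p∪q∣≤∣p∣+∣q∣ p q

∣⋃∣≤ : ∀ {A : Set} {n} {f : A → Subset n} {m} (xs : List A) → (∀ x → ∣ f x ∣ ≤ m) →
       ∣ ⋃ (map f xs) ∣ ≤ length xs * m
∣⋃∣≤ {n = n} []       f≤m = ≤-reflexive (∣⊥∣≡0 n)
∣⋃∣≤ {f = f} (x ∷ xs) f≤m =
  ≤-trans (∣p∪q∣≤∣p∣+∣q∣ (f x) _) (+-mono-≤ (f≤m x) (∣⋃∣≤ xs f≤m))

∈-⋃⁺ : ∀ {A : Set} {n} {f : A → Subset n} {xs x i} → x ∈ xs → i ∈ˢ f x → i ∈ˢ ⋃ (map f xs)
∈-⋃⁺ (here refl) i∈ = x∈p∪q⁺ (inj₁ i∈)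
∈-⋃⁺ (there x∈)  i∈ = x∈p∪q⁺ (inj₂ (∈-⋃⁺ x∈ i∈))

maxOver-upper : ∀ n (f : Fin n → ℕ) i → f i ≤ maxOver n f
maxOver-upper n f i = All.lookup (xs≤max 0 (map f (allFin n))) (∈-map⁺ f (∈-allFin i))

maxOver-least : ∀ n (f : Fin n → ℕ) {m} → (∀ i → f i ≤ m) → maxOver n f ≤ m
maxOver-least n f f≤m = max≤v⁺ z≤n (All.map⁺ {xs = allFin n} (All.tabulate λ {i} _ → f≤m i))

-- Trees

Joins-sym : {A : Set} {p : A × A} {x y : A} → Joins p x y → Joins p y x
Joins-sym (inj₁ eq) = inj₂ eq
Joins-sym (inj₂ eq) = inj₁ eq

Joins⇒Incident : {A : Set} {p : A × A} {x y : A} → Joins p x y → Incident x p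
Joins⇒Incident (inj₁ refl) = inj₁ refl
Joins⇒Incident (inj₂ refl) = inj₂ refl

Incident⇒Joins : {A : Set} {p : A × A} {x : A} → Incident x p → ∃ (Joins p x)
Incident⇒Joins (inj₁ refl) = _ , inj₁ refl
Incident⇒Joins (inj₂ refl) = _ , inj₂ refl

Joins-other : {A : Set} {p : A × A} {x y z : A} → Joins p x y → Incident z p → z ≡ x ⊎ z ≡ y
Joins-other (inj₁ refl) (inj₁ refl) = inj₁ refl
Joins-other (inj₁ refl) (inj₂ refl) = inj₂ refl
Joins-other (inj₂ refl) (inj₁ refl) = inj₂ refl
Joins-other (inj₂ refl) (inj₂ refl) = inj₁ refl

module Reachability (T : Graph) where
  open Graph T

  -- `Connected∖ e` unfolds to the case where `K f` is `f ≢ e`; the other important case is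
  -- `Avoids t`, connection by edges that miss the node `t`.
  Reach : (Edge → Set) → Vertex → Vertex → Set
  Reach K = Star (λ x y → ∃ λ f → K f × Joins (ends f) x y)

  reach-sym : ∀ {K x y} → Reach K x y → Reach K y x
  reach-sym = Star.reverse λ { (f , k , j) → f , k , Joins-sym j }

  reach-map : ∀ {K L x y} → (∀ {f} → K f → L f) → Reach K x y → Reach L x y
  reach-map K⇒L = Star.map λ { (f , k , j) → f , K⇒L k , j }

  reach-walk : ∀ {K x y} (w : Walk x y) → All K (edges w) → Reach K x y
  reach-walk []           []       = ε
  reach-walk (step e j w) (k ∷ ks) = (e , k , j) ◅ reach-walk w ks

  module _ {K : Edge → Set} where

    private
      PathIn : Vertex → Vertex → Set
      PathIn x y = Σ (Path x y) λ p → All K (edges (proj₁ p))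

      suffix : ∀ {x y z} (w : Walk y z) → Unique (vertices w) → All K (edges w) →
               x ∈ vertices w → PathIn x z
      suffix []           u       ks       (here refl) = ([] , u) , ks
      suffix (step e j w) u       ks       (here refl) = (step e j w , u) , ks
      suffix (step e j w) (_ ∷ u) (_ ∷ ks) (there x∈)  = suffix w u ks x∈

    -- If `x` already lies on the path built for the rest, the loop is cut off by passing to a
    -- suffix. This only drops edges, so `K` persists.
    reach-path : ∀ {x y} → Reach K x y → PathIn x y
    reach-path ε = ([] , [] ∷ []) , []
    reach-path {x} ((f , k , j) ◅ r) with reach-path r
    ... | (w , u) , ks with DecMembership._∈?_ _≟ᶠ_ x (vertices w)
    ...   | yes x∈ = suffix w u ks x∈
    ...   | no x∉  = (step f j w , All.¬Any⇒All¬ _ x∉ ∷ u) , k ∷ ks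

  Avoids : Vertex → Edge → Set
  Avoids t f = ¬ Incident t (ends f)

  walk-avoids : ∀ {t x y} (w : Walk x y) → t ∉ vertices w → All (Avoids t) (edges w)
  walk-avoids []           t∉ = []
  walk-avoids (step e j w) t∉ =
    (λ i → [ t∉ ∘ here , t∉ ∘ there ∘ (λ { refl → head w }) ] (Joins-other j i))
    ∷ walk-avoids w (t∉ ∘ there)
    where
    head : ∀ {x y} (w : Walk x y) → x ∈ vertices w
    head []           = here refl
    head (step _ _ _) = here refl

  avoids⇒≢ : ∀ {t e f} → Incident t (ends e) → Avoids t f → f ≢ e
  avoids⇒≢ i ¬i refl = ¬i i

  -- The path of a cycle would join the ends of the closing edge without using it. Bridges are
  -- easier to carry over to a modified tree than acyclicity, because walks, unlike paths, can be
  -- mapped and concatenated freely.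
  isTree⁺ : Vertex → (∀ x y → Reach (λ _ → ⊤) x y) →
            (∀ e → ¬ Connected∖ e (proj₁ (ends e)) (proj₂ (ends e))) → IsTree T
  isTree⁺ v reach bridge = record
    { nonempty  = v
    ; connected = λ x y → proj₁ (reach-path (reach x y))
    ; acyclic   = λ { (x , y , (w , _) , e , j , e∉) → cut e j
        (reach-walk w (All.map (λ e≢f f≡e → e≢f (sym f≡e)) (All.¬Any⇒All¬ _ e∉))) }
    }
    where
    cut : ∀ e {x y} → Joins (ends e) x y → ¬ Connected∖ e x y
    cut e (inj₁ refl) r = bridge e r
    cut e (inj₂ refl) r = bridge e (reach-sym r)

module Tree {T : Graph} (isTree : IsTree T) where
  open Graph T
  open IsTree isTree
  open Reachability T

  bridge : ∀ {e x y} → Joins (ends e) x y → ¬ Connected∖ e x y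
  bridge {e} j r with reach-path r
  ... | p , e∉ = acyclic (_ , _ , p , e , j , λ e∈ → All.lookup e∉ e∈ refl)

  Far : Edge → Vertex → Vertex → Set
  Far e t a = ¬ Connected∖ e t a

  far? : ∀ e t a → Dec (Far e t a)
  far? e t a = ¬? (connected∖? e t a)

  ¬far : ∀ {e t a} → ¬ Far e t a → Connected∖ e t a
  ¬far = decidable-stable (connected∖? _ _ _)

  far-resp : ∀ {e t a b} → Connected∖ e a b → Far e t a → Far e t b
  far-resp r far r′ = far (r′ ◅◅ reach-sym r)

  -- `e` is the first edge of the path from `t` to `a`; a path does not return to `t`, so the rest
  -- avoids it.
  branch : ∀ {t a} → t ≢ a → ∃₂ λ e s → Joins (ends e) t s × Reach (Avoids t) s a
  branch {t} {a} t≢a with connected t a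
  ... | [] , _               = contradiction refl t≢a
  ... | step e j w , t≢ ∷ _ = e , _ , j , reach-walk w (walk-avoids w (All.All¬⇒¬Any t≢))

  branch-far : ∀ {e t s a} → Joins (ends e) t s → Reach (Avoids t) s a → Far e t a
  branch-far j r r′ = bridge j (r′ ◅◅ reach-sym (reach-map (avoids⇒≢ (Joins⇒Incident j)) r))

  -- An edge at `t` other than `e` is missed by the rest of the path, which avoids `t`, and so
  -- cannot separate `t` from `a`.
  branch-unique : ∀ {e e′ t s a} → Joins (ends e) t s → Reach (Avoids t) s a →
                  Incident t (ends e′) → Far e′ t a → e′ ≡ e
  branch-unique {e} {e′} j r i far = decidable-stable (e′ ≟ᶠ e) λ e′≢e →
    far ((e , e′≢e ∘ sym , j) ◅ reach-map (avoids⇒≢ i) r)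

  far-irrefl : ∀ {e t} → ¬ Far e t t
  far-irrefl far = far ε

  far-exists : ∀ {t a} → t ≢ a → ∃ λ e → Incident t (ends e) × Far e t a
  far-exists t≢a with branch t≢a
  ... | e , s , j , r = e , Joins⇒Incident j , branch-far j r

  -- Both edges are the first edge of the path from `t` to `a`. With `far-exists`, every node other
  -- than `t` lies beyond exactly one edge at `t`, so branches can be named by edges.
  far-unique : ∀ {e e′ t a} → Incident t (ends e) → Incident t (ends e′) →
               Far e t a → Far e′ t a → e ≡ e′
  far-unique i i′ far far′ with branch (λ { refl → far-irrefl far })
  ... | _ , _ , j , r = trans (branch-unique j r i far) (sym (branch-unique j r i′ far′))

  two-sides : ∀ {e t s} → Joins (ends e) t s → ∀ a → Connected∖ e t a ⊎ Connected∖ e s a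
  two-sides {e} {t} {s} j a =
    extend (inj₁ ε) (reach-walk {K = λ _ → ⊤} (proj₁ (connected t a)) (All.tabulate _))
    where
    extend : ∀ {x y} → Connected∖ e t x ⊎ Connected∖ e s x → Reach (λ _ → ⊤) x y →
             Connected∖ e t y ⊎ Connected∖ e s y
    extend c ε = c
    extend c ((f , _ , j′) ◅ r) with f ≟ᶠ e
    extend (inj₁ c) ((f , _ , j′) ◅ r) | no f≢e = extend (inj₁ (c ◅◅ (f , f≢e , j′) ◅ ε)) r
    extend (inj₂ c) ((f , _ , j′) ◅ r) | no f≢e = extend (inj₂ (c ◅◅ (f , f≢e , j′) ◅ ε)) r
    -- Crossing `e` lands on one of its two ends, so the side recorded so far is dropped and
    -- restarted at that end.
    ... | yes refl with Joins-other j (Joins⇒Incident (Joins-sym j′))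
    ...   | inj₁ refl = extend (inj₁ ε) r
    ...   | inj₂ refl = extend (inj₂ ε) r

  far-far : ∀ {e t a b} → Incident t (ends e) → Far e t a → Far e t b → Connected∖ e a b
  far-far {a = a} {b} i fa fb with Incident⇒Joins i
  ... | s , j with two-sides j a | two-sides j b
  ... | inj₁ c | _      = contradiction c fa
  ... | inj₂ _ | inj₁ c = contradiction c fb
  ... | inj₂ c | inj₂ d = reach-sym c ◅◅ d

  -- The edge is the one by which the path enters `t`: the part before it stays on the side of `a`,
  -- and the part after it never uses it again.
  path-through : ∀ {t a b} (w : Walk a b) → Unique (vertices w) → t ∈ vertices w → t ≢ a →
                 ∃ λ e → Incident t (ends e) × Far e t a × Connected∖ e t b
  path-through []           u (here refl) t≢a = contradiction refl t≢a
  path-through (step f j w) u (here refl) t≢a = contradiction refl t≢a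
  path-through {t} (step {y = y} f j w) (a∉ ∷ u) (there t∈) t≢a with t ≟ᶠ y
  ... | yes refl =
    f , Joins⇒Incident (Joins-sym j) , bridge (Joins-sym j) ,
    reach-walk w (All.map (avoids⇒≢ (Joins⇒Incident j)) (walk-avoids w (All.All¬⇒¬Any a∉)))
  ... | no t≢y with path-through w u t∈ t≢y
  ...   | e , i , far , c =
    e , i , far-resp ((f , (λ { refl → [ t≢a , t≢y ] (Joins-other j i) }) , Joins-sym j) ◅ ε) far , c

  path-around : ∀ {t a b} (w : Walk a b) → t ∉ vertices w → Reach (Avoids t) a b
  path-around w t∉ = reach-walk w (walk-avoids w t∉)

-- Cuts and torsos of a decomposition

differ? : {A : Set} (χ : A → Bool) → Decidable (λ (p : A × A) → χ (proj₁ p) ≢ χ (proj₂ p))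
differ? χ p = ¬? (χ (proj₁ p) ≟ᵇ χ (proj₂ p))

-- The size of the edge boundary of a vertex set, given by its indicator `χ`. Adhesions and degrees
-- are compared through such numbers.
cut : {A : Set} → (A → Bool) → List (A × A) → ℕ
cut χ = count (differ? χ)

edgeEnds : (G : Graph) → List (Graph.Vertex G × Graph.Vertex G)
edgeEnds G = map (Graph.ends G) (allFin (Graph.size G))

module Decomposition {G : Graph} (D : TreeCutDecomposition G) where
  open Graph G using (Vertex; Edge; order; size; ends)
  open TreeCutDecomposition D
  open Tree isTree public
  open Reachability tree public

  boldEdges : T.Vertex → List T.Edge
  boldEdges t = filter (λ e → bold? e ×-dec incident? _≟ᶠ_ t (T.ends e)) (allFin T.size)

  separates? : ∀ e → Decidable (λ f → ¬ T.Connected∖ e (nodeOf (proj₁ (ends f))) (nodeOf (proj₂ (ends f))))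
  separates? e f = ¬? (T.connected∖? e (nodeOf (proj₁ (ends f))) (nodeOf (proj₂ (ends f))))

  inequivalent? : ∀ t → Decidable (λ f → ¬ Equiv t (proj₁ (ends f)) (proj₂ (ends f)))
  inequivalent? t f = ¬? (equiv? t (proj₁ (ends f)) (proj₂ (ends f)))

  classes : T.Vertex → Edge → Subset order × Subset order
  classes t f = class t (proj₁ (ends f)) , class t (proj₂ (ends f))

  FarFrom : T.Vertex → T.Edge → Vertex → Set
  FarFrom t e v = Incident t (T.ends e) × Far e t (nodeOf v)

  bag⇒nodeOf : ∀ {t v} → v ∈ˢ bag t → nodeOf v ≡ t
  bag⇒nodeOf {t} {v} v∈ = decidable-stable (nodeOf v ≟ᶠ t) λ ≢t →
    disjoint (nodeOf v) t ≢t (v , x∈p∩q⁺ (proj₂ (covers v) , v∈))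

  nodeOf⇒bag : ∀ {t v} → nodeOf v ≡ t → v ∈ˢ bag t
  nodeOf⇒bag {v = v} refl = proj₂ (covers v)

  adh⇒differ : ∀ {t e u v} {χ : Vertex → Bool} → Incident t (T.ends e) →
               (∀ {v} → FarFrom t e v → χ v ≡ true) → (∀ {v} → χ v ≡ true → FarFrom t e v) →
               ¬ T.Connected∖ e (nodeOf u) (nodeOf v) → χ u ≢ χ v
  adh⇒differ {t} {e} {u} {v} {χ} i f⇒χ χ⇒f sep χu≡χv
    with χ u in eq | far? e t (nodeOf u) | far? e t (nodeOf v)
  ... | _     | yes fu | yes fv = sep (far-far i fu fv)
  ... | _     | no  cu | no  cv = sep (reach-sym (¬far cu) ◅◅ ¬far cv)
  ... | true  | no  cu | _      = cu (proj₂ (χ⇒f eq))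
  ... | true  | _      | no  cv = cv (proj₂ (χ⇒f (sym χu≡χv)))
  ... | false | yes fu | _      with () ← trans (sym eq) (f⇒χ (i , fu))
  ... | false | _      | yes fv with () ← trans χu≡χv (f⇒χ (i , fv))

  -- The two hypotheses make `χ` the indicator of the vertices beyond `e`, and an edge of `G` with
  -- both ends on one side of `e` is not in its adhesion. Later bounds on adhesions thus need only
  -- `χ`, not the tree.
  ∣adh∣≤cut : ∀ {t e} (χ : Vertex → Bool) → Incident t (T.ends e) →
              (∀ {v} → FarFrom t e v → χ v ≡ true) → (∀ {v} → χ v ≡ true → FarFrom t e v) →
              ∣ adh e ∣ ≤ cut χ (edgeEnds G)
  ∣adh∣≤cut {t} {e} χ i f⇒χ χ⇒f = begin
    ∣ adh e ∣                           ≡⟨ ∣comprehension∣ (separates? e) ⟩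
    count (separates? e) (allFin size)  ≤⟨ count-mono (separates? e) (differ? χ ∘ ends) (allFin size)
                                                      (λ _ → adh⇒differ i f⇒χ χ⇒f) ⟩
    count (differ? χ ∘ ends) (allFin size) ≡⟨ count-map (differ? χ) ends (allFin size) ⟨
    cut χ (edgeEnds G)                  ∎
    where open ≤-Reasoning

  equiv-refl : ∀ {t u} → Equiv t u u
  equiv-refl = inj₁ refl

  equiv-far : ∀ {t e u v} → Equiv t u v → FarFrom t e u → FarFrom t e v
  equiv-far (inj₁ refl)         far       = far
  equiv-far {u = u} {v} (inj₂ (_ , t∉)) (i , far) =
    i , far-resp (reach-map (avoids⇒≢ i) (path-around (proj₁ (IsTree.connected isTree (nodeOf u) (nodeOf v))) t∉)) far

  -- If the trace met `t`, it would enter `t` by the edge towards `u`, which is `e`, and then reach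
  -- `v` without `e`. With `equiv-far`, the classes outside the bag are exactly the inhabited
  -- branches at `t`.
  far-equiv : ∀ {t e u v} → FarFrom t e u → FarFrom t e v → Equiv t u v
  far-equiv {t} {e} {u} {v} (i , fu) (_ , fv) with u ≟ᶠ v | DecMembership._∈?_ _≟ᶠ_ t (trace u v)
  ... | yes u≡v | _     = inj₁ u≡v
  ... | no  u≢v | no t∉ = inj₂ (u≢v , t∉)
  ... | no  u≢v | yes t∈
    with (w , uniq) ← IsTree.connected isTree (nodeOf u) (nodeOf v)
    with e′ , i′ , far , c ← path-through w uniq t∈ (λ eq → far-irrefl (subst (Far e t) (sym eq) fu))
    with refl ← far-unique i i′ fu far = contradiction c fv

  equiv-bag : ∀ {t u v} → nodeOf u ≡ t ⊎ nodeOf v ≡ t → Equiv t u v → u ≡ v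
  equiv-bag t∈ (inj₁ u≡v)      = u≡v
  equiv-bag {u = u} {v} t∈ (inj₂ (_ , t∉)) =
    contradiction (end (proj₁ (IsTree.connected isTree (nodeOf u) (nodeOf v))) t∈) t∉
    where
    end : ∀ {t x y} (w : T.Walk x y) → x ≡ t ⊎ y ≡ t → t ∈ T.vertices w
    end T.[]           (inj₁ refl) = here refl
    end T.[]           (inj₂ refl) = here refl
    end (T.step _ _ w) (inj₁ refl) = here refl
    end (T.step _ _ w) (inj₂ refl) = there (end w (inj₂ refl))

  -- The path chosen from `nodeOf v` to `nodeOf u` is not by definition the reverse of the one used
  -- for `u` and `v`, so symmetry is derived from the description by branches.
  equiv-sym : ∀ {t u v} → Equiv t u v → Equiv t v u
  equiv-sym {t} {u} u~v with t ≟ᶠ nodeOf u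
  ... | yes t≡ with refl ← equiv-bag (inj₁ (sym t≡)) u~v = equiv-refl
  ... | no  t≢ with _ , far ← far-exists t≢ = far-equiv (equiv-far u~v far) far

  equiv-trans : ∀ {t u v w} → Equiv t u v → Equiv t v w → Equiv t u w
  equiv-trans {t} {u} u~v v~w with t ≟ᶠ nodeOf u
  ... | yes t≡ with refl ← equiv-bag (inj₁ (sym t≡)) u~v = v~w
  ... | no  t≢ with _ , far ← far-exists t≢ = far-equiv far (equiv-far v~w (equiv-far u~v far))

  class⇒equiv : ∀ {t u v} → class t u ≡ class t v → Equiv t u v
  class⇒equiv {t} {u} {v} eq = ∈-comprehension⁻ (λ w → equiv? t w v)
    (subst (u ∈ˢ_) eq (∈-comprehension⁺ (λ w → equiv? t w u) equiv-refl))

  equiv⇒class : ∀ {t u v} → Equiv t u v → class t u ≡ class t v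
  equiv⇒class {t} {u} {v} u~v = ⊆-antisym (sub u~v) (sub (equiv-sym u~v))
    where
    sub : ∀ {u v} → Equiv t u v → ∀ {w} → w ∈ˢ class t u → w ∈ˢ class t v
    sub {u} {v} u~v w∈ = ∈-comprehension⁺ (λ w → equiv? t w v)
      (equiv-trans (∈-comprehension⁻ (λ w → equiv? t w u) w∈) u~v)

  inBag⇒nodeOf : ∀ {t v} → InBag t (class t v) → nodeOf v ≡ t
  inBag⇒nodeOf (w , w∈ , eq) with refl ← equiv-bag (inj₂ (bag⇒nodeOf w∈)) (class⇒equiv eq) = bag⇒nodeOf w∈

  nodeOf⇒inBag : ∀ {t v} → nodeOf v ≡ t → InBag t (class t v)
  nodeOf⇒inBag {v = v} eq = v , nodeOf⇒bag eq , refl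

  -- If `e` did not separate the ends of `f`, both would lie in the branch of `v`, hence be
  -- equivalent, and `f` would not be an edge of the torso.
  torso-incident : ∀ {t e v f} → FarFrom t e v →
                   ¬ Equiv t (proj₁ (ends f)) (proj₂ (ends f)) →
                   Incident (class t v) (class t (proj₁ (ends f)) , class t (proj₂ (ends f))) →
                   ¬ T.Connected∖ e (nodeOf (proj₁ (ends f))) (nodeOf (proj₂ (ends f)))
  torso-incident far ≁ (inj₁ eq) c with i , far′ ← equiv-far (class⇒equiv eq) far =
    ≁ (far-equiv (i , far′) (i , far-resp c far′))
  torso-incident far ≁ (inj₂ eq) c with i , far′ ← equiv-far (class⇒equiv eq) far =
    ≁ (far-equiv (i , far-resp (reach-sym c) far′) (i , far′))

  torso-degree-count : ∀ t C → Suppression.degree _≟ˢ_ (torso t) C ≡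
                       count (λ f → incident? _≟ˢ_ C (classes t f) ×-dec inequivalent? t f) (allFin size)
  torso-degree-count t C = trans
    (count-map (incident? _≟ˢ_ C) (classes t) (filter (inequivalent? t) (allFin size)))
    (count-filter (incident? _≟ˢ_ C ∘ classes t) (inequivalent? t) (allFin size))

  torso-degree : ∀ {t e v} → FarFrom t e v →
                 Suppression.degree _≟ˢ_ (torso t) (class t v) ≤ ∣ adh e ∣
  torso-degree {t} {e} {v} far = begin
    Suppression.degree _≟ˢ_ (torso t) (class t v)
      ≡⟨ torso-degree-count t (class t v) ⟩
    count (λ f → incident? _≟ˢ_ (class t v) (classes t f) ×-dec inequivalent? t f) (allFin size)
      ≤⟨ count-mono _ (separates? e) (allFin size) (λ { _ (inc , ≁) → torso-incident far ≁ inc }) ⟩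
    count (separates? e) (allFin size)
      ≡⟨ ∣comprehension∣ (separates? e) ⟨
    ∣ adh e ∣ ∎
    where open ≤-Reasoning

  -- The edges of `G` discarded by the torso have equivalent ends, so `Q ∘ class t` never cuts them.
  torso-cut : ∀ t (Q : Subset order → Bool) → cut (Q ∘ class t) (edgeEnds G) ≤ cut Q (edgeList (torso t))
  torso-cut t Q = begin
    cut (Q ∘ class t) (edgeEnds G)
      ≡⟨ count-map (differ? (Q ∘ class t)) ends (allFin size) ⟩
    count (differ? Q ∘ classes t) (allFin size)
      ≤⟨ count-mono _ (λ f → differ? Q (classes t f) ×-dec inequivalent? t f) (allFin size)
           (λ _ d → d , λ u~v → d (cong Q (equiv⇒class u~v))) ⟩
    count (λ f → differ? Q (classes t f) ×-dec inequivalent? t f) (allFin size)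
      ≡⟨ count-filter (differ? Q ∘ classes t) (inequivalent? t) (allFin size) ⟨
    count (differ? Q ∘ classes t) (filter (inequivalent? t) (allFin size))
      ≡⟨ count-map (differ? Q) (classes t) (filter (inequivalent? t) (allFin size)) ⟨
    cut Q (edgeList (torso t)) ∎
    where open ≤-Reasoning

-- Suppression

Joins-unique : {A : Set} {p : A × A} {x y z : A} → Joins p x y → Joins p x z → y ≡ z
Joins-unique (inj₁ refl) (inj₁ refl) = refl
Joins-unique (inj₁ refl) (inj₂ refl) = refl
Joins-unique (inj₂ refl) (inj₁ refl) = refl
Joins-unique (inj₂ refl) (inj₂ refl) = refl

Joins-differ : {A : Set} {p : A × A} {x y : A} (Q : A → Bool) → Joins p x y →
               Q (proj₁ p) ≢ Q (proj₂ p) → Q x ≢ Q y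
Joins-differ Q (inj₁ refl) d = d
Joins-differ Q (inj₂ refl) d = d ∘ sym

module SuppressionProperties {A : Set} (_≟_ : DecidableEquality A) where
  open Suppression _≟_

  WellFormed : Multigraph A → Set
  WellFormed H = Unique (vertexList H) ×
    (∀ {p} → p ∈ edgeList H → proj₁ p ∈ vertexList H × proj₂ p ∈ vertexList H × proj₁ p ≢ proj₂ p)

  incidentEdges remainingEdges : Multigraph A → A → List (A × A)
  incidentEdges  H x = filter (incident? _≟_ x) (edgeList H)
  remainingEdges H x = filter (λ p → ¬? (incident? _≟_ x p)) (edgeList H)

  adjacent? : ∀ H x → Decidable (λ y → Any (λ p → Joins p x y) (edgeList H))
  adjacent? H x y = Any.any? (λ p → joins? _≟_ p x y) (edgeList H)

  neighbour⁻ : ∀ {H x y} → y ∈ neighbours H x → y ∈ vertexList H × ∃ λ p → p ∈ edgeList H × Joins p x y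
  neighbour⁻ {H} {x} y∈ with y∈V , a ← ∈-filter⁻ (adjacent? H x) {xs = vertexList H} y∈ = y∈V , find a

  incident-neighbour : ∀ {H x p} → WellFormed H → p ∈ incidentEdges H x →
                       ∃ λ y → y ∈ neighbours H x × Joins p x y
  incident-neighbour {H} {x} wf p∈ with ∈-filter⁻ (incident? _≟_ x) {xs = edgeList H} p∈
  ... | p∈E , inj₁ refl =
    _ , ∈-filter⁺ (adjacent? H x) (proj₁ (proj₂ (proj₂ wf p∈E))) (lose p∈E (inj₁ refl)) , inj₁ refl
  ... | p∈E , inj₂ refl =
    _ , ∈-filter⁺ (adjacent? H x) (proj₁ (proj₂ wf p∈E)) (lose p∈E (inj₂ refl)) , inj₂ refl

  neighbour-incident : ∀ {H x y} → y ∈ neighbours H x → ∃ λ p → p ∈ incidentEdges H x × Joins p x y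
  neighbour-incident {H} {x} y∈ with _ , p , p∈ , j ← neighbour⁻ {H} y∈ =
    p , ∈-filter⁺ (incident? _≟_ x) p∈ (Joins⇒Incident j) , j

  neighbours-unique : ∀ {H x} → WellFormed H → Unique (neighbours H x)
  neighbours-unique {H} {x} wf = unique-filter (adjacent? H x) (proj₁ wf)

  neighbour≢ : ∀ {H x y} → WellFormed H → y ∈ neighbours H x → y ≢ x
  neighbour≢ {H} wf y∈ refl with neighbour⁻ {H} y∈
  ... | _ , p , p∈ , inj₁ refl = proj₂ (proj₂ (proj₂ wf p∈)) refl
  ... | _ , p , p∈ , inj₂ refl = proj₂ (proj₂ (proj₂ wf p∈)) refl

  length-neighbours : ∀ {H x} → WellFormed H → length (neighbours H x) ≤ degree H x
  length-neighbours {H} {x} wf = pigeonhole (λ y p → Joins p x y) (incidentEdges H x)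
    (neighbours-unique {H} {x} wf) (λ y∈ → neighbour-incident {H} y∈) (λ _ _ → Joins-unique)

  data Suppressed (H : Multigraph A) (x : A) : Multigraph A → Set where
    isolated : neighbours H x ≡ [] → Suppressed H x (delete H x)
    pendant  : ∀ y → neighbours H x ≡ y ∷ [] → Suppressed H x (delete H x)
    between  : ∀ y z → neighbours H x ≡ y ∷ z ∷ [] → Suppressed H x (addEdge (y , z) (delete H x))

  suppress-view : ∀ {H x} → WellFormed H → degree H x ≤ 2 → Suppressed H x (suppress H x)
  suppress-view {H} {x} wf d≤2 with neighbours H x in eq | length-neighbours {H} {x} wf
  ... | []            | _ = isolated eq
  ... | y ∷ []        | _ = pendant y eq
  ... | y ∷ z ∷ []    | _ = between y z eq
  ... | _ ∷ _ ∷ _ ∷ _ | l with s≤s (s≤s ()) ← ≤-trans l d≤2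

  suppress-vertices : ∀ H x → vertexList (suppress H x) ≡ filter (λ y → ¬? (y ≟ x)) (vertexList H)
  suppress-vertices H x with neighbours H x
  ... | []            = refl
  ... | _ ∷ []        = refl
  ... | _ ∷ _ ∷ []    = refl
  ... | _ ∷ _ ∷ _ ∷ _ = refl

  ∈-suppress⁺ : ∀ {H x y} → y ∈ vertexList H → y ≢ x → y ∈ vertexList (suppress H x)
  ∈-suppress⁺ {H} {x} y∈ y≢x rewrite suppress-vertices H x = ∈-filter⁺ (λ y → ¬? (y ≟ x)) y∈ y≢x

  ∈-suppress⁻ : ∀ {H x y} → y ∈ vertexList (suppress H x) → y ∈ vertexList H × y ≢ x
  ∈-suppress⁻ {H} {x} y∈ rewrite suppress-vertices H x = ∈-filter⁻ (λ y → ¬? (y ≟ x)) {xs = vertexList H} y∈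

  length-suppress : ∀ {H x} → x ∈ vertexList H → length (vertexList (suppress H x)) < length (vertexList H)
  length-suppress {H} {x} x∈ rewrite suppress-vertices H x =
    filter-notAll (λ y → ¬? (y ≟ x)) (vertexList H) (Any.map (λ { refl ¬≢ → ¬≢ refl }) x∈)

  delete-wellFormed : ∀ {H x} → WellFormed H → WellFormed (delete H x)
  delete-wellFormed {H} {x} (u , wf) = unique-filter (λ y → ¬? (y ≟ x)) u , λ p∈ →
    let p∈E , ¬i = ∈-filter⁻ (λ p → ¬? (incident? _≟_ x p)) {xs = edgeList H} p∈
        a∈ , b∈ , a≢b = wf p∈E
    in ∈-filter⁺ (λ y → ¬? (y ≟ x)) a∈ (¬i ∘ inj₁ ∘ sym) ,
       ∈-filter⁺ (λ y → ¬? (y ≟ x)) b∈ (¬i ∘ inj₂ ∘ sym) , a≢b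

  suppress-wellFormed : ∀ {H x} → WellFormed H → degree H x ≤ 2 → WellFormed (suppress H x)
  suppress-wellFormed {H} {x} wf d≤2 with suppress H x | suppress-view wf d≤2
  ... | _ | isolated _ = delete-wellFormed wf
  ... | _ | pendant _ _ = delete-wellFormed wf
  ... | _ | between y z eq = proj₁ (delete-wellFormed wf) , λ
    { (here refl) → live (subst (y ∈_) (sym eq) (here refl)) , live (subst (z ∈_) (sym eq) (there (here refl))) ,
                    distinct (subst Unique eq (neighbours-unique wf))
    ; (there p∈)  → proj₂ (delete-wellFormed wf) p∈ }
    where
    live : ∀ {v} → v ∈ neighbours H x → v ∈ vertexList (delete H x)
    live v∈ = ∈-filter⁺ (λ y → ¬? (y ≟ x)) (proj₁ (neighbour⁻ {H} v∈)) (neighbour≢ wf v∈)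

    distinct : ∀ {y z} → Unique (y ∷ z ∷ []) → y ≢ z
    distinct ((y≢z ∷ []) ∷ _) = y≢z

  -- The edge added between the two neighbours of `x` raises their degrees by one, but each of them
  -- has just lost an edge to `x`.
  suppress-degree : ∀ {H x} → WellFormed H → degree H x ≤ 2 → ∀ y → degree (suppress H x) y ≤ degree H y
  suppress-degree {H} {x} wf d≤2 y = go (suppress-view wf d≤2)
    where
    split = count-split (incident? _≟_ y) (incident? _≟_ x) (edgeList H)

    deleted : degree (delete H x) y ≤ degree H y
    deleted = ≤-trans (m≤n+m _ _) (≤-reflexive (sym split))

    adjacent : y ∈ neighbours H x → suc (degree (delete H x) y) ≤ degree H y
    adjacent y∈ with p , p∈ , j ← neighbour-incident {H} y∈ =
      ≤-trans (+-monoˡ-≤ _ (nonempty (∈-filter⁺ (incident? _≟_ y) p∈ (Joins⇒Incident (Joins-sym j)))))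
              (≤-reflexive (sym split))
      where
      nonempty : ∀ {p} {ps : List (A × A)} → p ∈ ps → 1 ≤ length ps
      nonempty (here _)  = s≤s z≤n
      nonempty (there _) = s≤s z≤n

    go : ∀ {K} → Suppressed H x K → degree K y ≤ degree H y
    go (isolated _)  = deleted
    go (pendant _ _) = deleted
    go (between a b eq) with incident? _≟_ y (a , b)
    ... | no ¬i = ≤-trans (≤-reflexive (cong length (filter-reject (incident? _≟_ y) ¬i))) deleted
    ... | yes i = ≤-trans (≤-reflexive (cong length (filter-accept (incident? _≟_ y) i)))
                          (adjacent (subst (y ∈_) (sym eq) (end i)))
      where
      end : Incident y (a , b) → y ∈ a ∷ b ∷ []
      end (inj₁ refl) = here refl
      end (inj₂ refl) = there (here refl)

  -- Suppressing x contracts it into a neighbour y, so no cut with x and y on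
  -- the same side gets smaller.
  suppress-cut : ∀ {H x} → WellFormed H → degree H x ≤ 2 → (Q : A → Bool) →
                 neighbours H x ≡ [] ⊎ (∃ λ y → y ∈ neighbours H x × Q x ≡ Q y) →
                 cut Q (edgeList H) ≤ cut Q (edgeList (suppress H x))
  suppress-cut {H} {x} wf d≤2 Q same = go (suppress-view wf d≤2)
    where
    split = count-split (differ? Q) (incident? _≟_ x) (edgeList H)

    uncut : (∀ {y} → y ∈ neighbours H x → Q x ≡ Q y) → cut Q (edgeList H) ≤ cut Q (remainingEdges H x)
    uncut all = ≤-reflexive (trans split (cong (_+ cut Q (remainingEdges H x))
      (count-none (differ? Q) (incidentEdges H x) λ p∈ d →
        let _ , y∈ , j = incident-neighbour {H} wf p∈ in Joins-differ Q j d (all y∈))))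

    oneCut : cut Q (edgeList H) ≤ suc (cut Q (remainingEdges H x))
    oneCut = ≤-trans (≤-reflexive split) (+-monoˡ-≤ _ (few same))
      where
      few : neighbours H x ≡ [] ⊎ (∃ λ y → y ∈ neighbours H x × Q x ≡ Q y) → cut Q (incidentEdges H x) ≤ 1
      few (inj₁ none) = ≤-trans (≤-reflexive (count-none (differ? Q) (incidentEdges H x) λ p∈ _ →
        let y , y∈ , _ = incident-neighbour {H} wf p∈ in contradiction (subst (y ∈_) none y∈) λ ())) z≤n
      few (inj₂ (y , y∈ , Qx≡Qy)) = s≤s⁻¹ (≤-trans
        (filter-notAll (differ? Q) (incidentEdges H x)
          (let _ , p∈ , j = neighbour-incident {H} y∈ in lose p∈ λ d → Joins-differ Q j d Qx≡Qy))
        d≤2)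

    go : ∀ {K} → Suppressed H x K → cut Q (edgeList H) ≤ cut Q (edgeList K)
    go (isolated eq) = uncut λ y∈ → contradiction (subst (_ ∈_) eq y∈) λ ()
    go (pendant y eq) = uncut (λ y∈ → sole (subst (_ ∈_) eq y∈) same)
      where
      sole : ∀ {z} → z ∈ y ∷ [] → neighbours H x ≡ [] ⊎ (∃ λ y → y ∈ neighbours H x × Q x ≡ Q y) → Q x ≡ Q z
      sole _ (inj₁ none) with () ← trans (sym eq) none
      sole (here refl) (inj₂ (w , w∈ , Qx≡Qw)) with here refl ← subst (w ∈_) eq w∈ = Qx≡Qw
    -- If `Q` separates `y` and `z`, the new edge pays for the single cut edge at `x`; otherwise `Q`
    -- agrees on `x`, `y` and `z`, and no edge at `x` is cut.
    go (between y z eq) with differ? Q (y , z)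
    ... | yes d = ≤-trans oneCut (≤-reflexive (sym (cong length (filter-accept (differ? Q) d))))
    ... | no ¬d = ≤-trans (uncut (λ y∈ → either (subst (_ ∈_) eq y∈) same))
                          (≤-reflexive (sym (cong length (filter-reject (differ? Q) ¬d))))
      where
      Qy≡Qz : Q y ≡ Q z
      Qy≡Qz = decidable-stable (Q y ≟ᵇ Q z) ¬d

      toY : ∀ {w} → w ∈ y ∷ z ∷ [] → Q w ≡ Q y
      toY (here refl)         = refl
      toY (there (here refl)) = sym Qy≡Qz

      either : ∀ {w} → w ∈ y ∷ z ∷ [] → neighbours H x ≡ [] ⊎ (∃ λ y → y ∈ neighbours H x × Q x ≡ Q y) → Q x ≡ Q w
      either _ (inj₁ none) with () ← trans (sym eq) none
      either w∈ (inj₂ (v , v∈ , Qx≡Qv)) = trans Qx≡Qv (trans (toY (subst (v ∈_) eq v∈)) (sym (toY w∈)))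

  module _ {Protected : A → Set} (protected? : ∀ x → Dec (Protected x)) where

    suppressible⁻ : ∀ {H x} → x ∈ suppressible protected? H → x ∈ vertexList H × degree H x ≤ 2 × ¬ Protected x
    suppressible⁻ {H} = ∈-filter⁻ (λ x → (degree H x ≤? 2) ×-dec ¬? (protected? x)) {xs = vertexList H}

    -- Each round removes a vertex, so a budget of at least the number of vertices cannot run out
    -- early: the process stops only when no unprotected vertex of degree at most 2 is left.
    suppressWithin-induction : (I : Multigraph A → Set) →
      (∀ {H x} → x ∈ vertexList H → degree H x ≤ 2 → ¬ Protected x → I H → I (suppress H x)) →
      ∀ n {H} → length (vertexList H) ≤ n → I H →
      I (suppressWithin protected? n H) ×
      (∀ {x} → x ∈ vertexList (suppressWithin protected? n H) → ¬ Protected x →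
       3 ≤ degree (suppressWithin protected? n H) x)
    suppressWithin-induction I step zero {H} V≤n i = i , λ x∈ → contradiction V≤n (<⇒≱ (nonempty x∈))
      where
      nonempty : ∀ {x} {xs : List A} → x ∈ xs → 0 < length xs
      nonempty (here _)  = s≤s z≤n
      nonempty (there _) = s≤s z≤n
    suppressWithin-induction I step (suc n) {H} V≤n i with suppressible protected? H in eq
    ... | [] = i , λ x∈ ¬p → ≰⇒> λ d≤2 → contradiction
      (subst (_ ∈_) eq (∈-filter⁺ (λ x → (degree H x ≤? 2) ×-dec ¬? (protected? x)) x∈ (d≤2 , ¬p))) λ ()
    ... | x ∷ _ with x∈ , d≤2 , ¬p ← suppressible⁻ {H} (subst (x ∈_) (sym eq) (here refl)) =
      suppressWithin-induction I step n (s≤s⁻¹ (≤-trans (length-suppress x∈) V≤n)) (step x∈ d≤2 ¬p i)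

-- Splitting a node

-- The node t is split in two: a new node with an empty bag is joined to t and
-- takes over the edges in A.  The new node and the new edge are both zero.
module Split {G : Graph} (D : TreeCutDecomposition G)
             (t : Graph.Vertex (TreeCutDecomposition.tree D))
             {A : Graph.Edge (TreeCutDecomposition.tree D) → Set} (A? : Decidable A)
             (A⇒incident : ∀ {e} → A e → Incident t (Graph.ends (TreeCutDecomposition.tree D) e))
             where
  open TreeCutDecomposition D
  open Decomposition D

  reroute : T.Edge → T.Vertex → Fin (suc T.order)
  reroute f x with (x ≟ᶠ t) ×-dec A? f
  ... | yes _ = zero
  ... | no _  = suc x

  -- Undoes the split by contracting the new edge; connectivity is compared between the two trees
  -- along this map.
  contract : Fin (suc T.order) → T.Vertex
  contract zero    = t
  contract (suc x) = x

  contract-reroute : ∀ f x → contract (reroute f x) ≡ x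
  contract-reroute f x with (x ≟ᶠ t) ×-dec A? f
  ... | yes (x≡t , _) = sym x≡t
  ... | no _          = refl

  reroute-moved : ∀ {f} → A f → reroute f t ≡ zero
  reroute-moved {f} a with (t ≟ᶠ t) ×-dec A? f
  ... | yes _ = refl
  ... | no ¬p = contradiction (refl , a) ¬p

  reroute-kept : ∀ {f x} → ¬ (x ≡ t × A f) → reroute f x ≡ suc x
  reroute-kept {f} {x} ¬p with (x ≟ᶠ t) ×-dec A? f
  ... | yes p = contradiction p ¬p
  ... | no _  = refl

  reroute-zero : ∀ {f x} → reroute f x ≡ zero → A f
  reroute-zero {f} {x} eq with (x ≟ᶠ t) ×-dec A? f
  ... | yes (_ , a) = a
  reroute-zero {f} {x} () | no _

  reroute-suc : ∀ {f x y} → reroute f x ≡ suc y → x ≡ y × ¬ (y ≡ t × A f)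
  reroute-suc {f} {x} eq with (x ≟ᶠ t) ×-dec A? f
  reroute-suc {f} {x} () | yes _
  reroute-suc {f} {x} refl | no ¬p = refl , ¬p

  splitEnds : Fin (suc T.size) → Fin (suc T.order) × Fin (suc T.order)
  splitEnds zero    = zero , suc t
  splitEnds (suc f) = reroute f (proj₁ (T.ends f)) , reroute f (proj₂ (T.ends f))

  splitTree : Graph
  splitTree = record
    { order    = suc T.order
    ; size     = suc T.size
    ; ends     = splitEnds
    ; loopless = λ
      { zero    → λ ()
      ; (suc f) → λ eq → T.loopless f (trans (sym (contract-reroute f _))
                                             (trans (cong contract eq) (contract-reroute f _))) }
    }

  module T′ = Graph splitTree
  module R′ = Reachability splitTree

  joins-lift : ∀ {f a b} → Joins (T.ends f) a b → Joins (splitEnds (suc f)) (reroute f a) (reroute f b)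
  joins-lift (inj₁ refl) = inj₁ refl
  joins-lift (inj₂ refl) = inj₂ refl

  joins-kept : ∀ {f a b} → ¬ (a ≡ t × A f) → ¬ (b ≡ t × A f) → Joins (T.ends f) a b →
               Joins (splitEnds (suc f)) (suc a) (suc b)
  joins-kept ¬a ¬b j = subst₂ (Joins (splitEnds (suc _))) (reroute-kept ¬a) (reroute-kept ¬b) (joins-lift j)

  joins-rerouted : ∀ {f x y} → Joins (splitEnds (suc f)) x y →
                   ∃₂ λ a b → Joins (T.ends f) a b × x ≡ reroute f a × y ≡ reroute f b
  joins-rerouted (inj₁ refl) = _ , _ , inj₁ refl , refl , refl
  joins-rerouted (inj₂ refl) = _ , _ , inj₂ refl , refl , refl

  module _ {K : T.Edge → Set} {K′ : T′.Edge → Set} where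

    reach-contract : (∀ {f} → K′ (suc f) → K f) → ∀ {x y} → R′.Reach K′ x y → Reach K (contract x) (contract y)
    reach-contract K′⇒K ε = ε
    reach-contract K′⇒K ((zero , _ , inj₁ refl) ◅ r) = reach-contract K′⇒K r
    reach-contract K′⇒K ((zero , _ , inj₂ refl) ◅ r) = reach-contract K′⇒K r
    reach-contract K′⇒K ((suc f , k , j) ◅ r) with joins-rerouted j | reach-contract K′⇒K r
    ... | a , b , j′ , refl , refl | r′ rewrite contract-reroute f a | contract-reroute f b =
      (f , K′⇒K k , j′) ◅ r′

    reach-fibre : K′ zero → ∀ x y → contract x ≡ contract y → R′.Reach K′ x y
    reach-fibre k zero    zero    eq   = ε
    reach-fibre k zero    (suc y) refl = (zero , k , inj₁ refl) ◅ ε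
    reach-fibre k (suc x) zero    refl = (zero , k , inj₂ refl) ◅ ε
    reach-fibre k (suc x) (suc y) refl = ε

    -- Consecutive lifted edges may meet in different halves of `t`; the gap is closed by the new
    -- edge, hence the assumption `K′ zero`.
    reach-lift : K′ zero → (∀ {f} → K f → K′ (suc f)) → ∀ {a b} → Reach K a b →
                 ∀ x y → contract x ≡ a → contract y ≡ b → R′.Reach K′ x y
    reach-lift k₀ K⇒K′ ε x y eq eq′ = reach-fibre k₀ x y (trans eq (sym eq′))
    reach-lift k₀ K⇒K′ (_◅_ {j = b} (f , k , j) r) x y eq eq′ =
      reach-fibre k₀ x (reroute f _) (trans eq (sym (contract-reroute f _)))
      ◅◅ (suc f , K⇒K′ k , joins-lift j) ◅ reach-lift k₀ K⇒K′ r (reroute f b) y (contract-reroute f b) eq′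

  connected-contract : ∀ {e x y} → T′.Connected∖ (suc e) x y → T.Connected∖ e (contract x) (contract y)
  connected-contract = reach-contract λ ≢e → ≢e ∘ cong suc

  connected-lift : ∀ {e x y} → T.Connected∖ e (contract x) (contract y) → T′.Connected∖ (suc e) x y
  connected-lift r = reach-lift (λ ()) (λ ≢e → ≢e ∘ suc-injective) r _ _ refl refl

  -- The side of the new node once the new edge is deleted, described in terms of the old tree.
  -- `moved-reach` shows that walks avoiding the new edge cannot leave it.
  Moved : T′.Vertex → Set
  Moved zero    = ⊤
  Moved (suc a) = ∃ λ e → A e × Far e t a

  moved-reroute : ∀ {f a b} → Dec (A f) → Joins (T.ends f) a b → Moved (reroute f a) → Moved (reroute f b)
  moved-reroute {f} {a} {b} (yes af) j m with Joins-other j (A⇒incident af)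
  ... | inj₂ refl = subst Moved (sym (reroute-moved af)) tt
  -- Here `a` is `t`, and `b` lies beyond `f`, which is itself one of the moved edges.
  ... | inj₁ refl with reroute f b | contract-reroute f b
  ...   | zero  | _    = tt
  ...   | suc _ | refl = f , af , bridge j
  moved-reroute {f} {a} {b} (no ¬af) j m
    rewrite reroute-kept {f} {a} (¬af ∘ proj₂) | reroute-kept {f} {b} (¬af ∘ proj₂)
    with e , ae , far ← m = e , ae , far-resp ((f , (λ { refl → ¬af ae }) , j) ◅ ε) far

  moved-step : ∀ {f x y} → Joins (splitEnds (suc f)) x y → Moved x → Moved y
  moved-step {f} j m with joins-rerouted j
  ... | a , b , j′ , refl , refl = moved-reroute (A? f) j′ m

  moved-reach : ∀ {x y} → T′.Connected∖ zero x y → Moved x → Moved y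
  moved-reach ε m = m
  moved-reach ((zero  , ≢0 , _) ◅ r) m = contradiction refl ≢0
  moved-reach ((suc f , _  , j) ◅ r) m = moved-reach r (moved-step j m)

  t-unmoved : ¬ Moved (suc t)
  t-unmoved (_ , _ , far) = far-irrefl far

  splitTree-isTree : IsTree splitTree
  splitTree-isTree = R′.isTree⁺ zero
    (λ x y → reach-lift tt (λ _ → tt)
      (reach-walk {K = λ _ → ⊤} (proj₁ (IsTree.connected isTree (contract x) (contract y))) (All.tabulate _))
      x y refl refl)
    λ { zero r    → t-unmoved (moved-reach r tt)
      ; (suc f) r → bridge (inj₁ refl)
          (subst₂ (T.Connected∖ f) (contract-reroute f _) (contract-reroute f _) (connected-contract r)) }

  splitBag : T′.Vertex → Subset (Graph.order G)
  splitBag zero    = ⊥ˢ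
  splitBag (suc s) = bag s

  splitDecomposition : TreeCutDecomposition G
  splitDecomposition = record
    { tree     = splitTree
    ; isTree   = splitTree-isTree
    ; bag      = splitBag
    ; disjoint = λ
      { zero    s       _   (v , v∈) → ∉⊥ (proj₁ (x∈p∩q⁻ ⊥ˢ (splitBag s) v∈))
      ; (suc r) zero    _   (v , v∈) → ∉⊥ (proj₂ (x∈p∩q⁻ (bag r) ⊥ˢ v∈))
      ; (suc r) (suc s) r≢s → disjoint r s (r≢s ∘ cong suc) }
    ; covers   = λ v → suc (nodeOf v) , proj₂ (covers v)
    }

  module D′  = TreeCutDecomposition splitDecomposition
  module DD′ = Decomposition splitDecomposition

  -- A walk avoiding `e` lifts to one avoiding `suc e`, so the new tree separates no further pairs
  -- at `suc e`.
  ∣adh∣-split : ∀ e → ∣ D′.adh (suc e) ∣ ≤ ∣ adh e ∣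
  ∣adh∣-split e = p⊆q⇒∣p∣≤∣q∣ λ f∈ → ∈-comprehension⁺ (separates? e)
    (∈-comprehension⁻ (DD′.separates? (suc e)) f∈ ∘ connected-lift)

  -- If the first edge towards `a` is not in `A`, the whole path from `t` to `a` survives the split
  -- unchanged and avoids the new edge.
  far-zero⁻ : ∀ {a} → DD′.Far zero (suc t) (suc a) → ∃ λ e → A e × Far e t a
  far-zero⁻ {a} far with t ≟ᶠ a
  ... | yes refl = contradiction far DD′.far-irrefl
  ... | no t≢a with branch t≢a
  ...   | e , s , j , r with A? e
  ...     | yes ae = e , ae , branch-far j r
  ...     | no ¬ae = contradiction
    ((suc e , (λ ()) , joins-kept (¬ae ∘ proj₂) (¬ae ∘ proj₂) j) ◅ lift r) far
    where
    lift : ∀ {x y} → Reach (Avoids t) x y → T′.Connected∖ zero (suc x) (suc y)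
    lift ε = ε
    lift ((f , av , j) ◅ r) =
      (suc f , (λ ()) , joins-kept (av ∘ A⇒incident ∘ proj₂) (av ∘ A⇒incident ∘ proj₂) j) ◅ lift r

  far-zero⁺ : ∀ {e a} → A e → Far e t a → DD′.Far zero (suc t) (suc a)
  far-zero⁺ {e} ae far r = t-unmoved (moved-reach (R′.reach-sym r) (e , ae , far))

  incident⁻ : ∀ {s e} → Incident (suc s) (splitEnds (suc e)) → Incident s (T.ends e) × ¬ (s ≡ t × A e)
  incident⁻ (inj₁ eq) with refl , ¬p ← reroute-suc (sym eq) = inj₁ refl , ¬p
  incident⁻ (inj₂ eq) with refl , ¬p ← reroute-suc (sym eq) = inj₂ refl , ¬p

  incident⁺ : ∀ {s e} → Incident s (T.ends e) → ¬ (s ≡ t × A e) → Incident (suc s) (splitEnds (suc e))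
  incident⁺ (inj₁ refl) ¬p = inj₁ (sym (reroute-kept ¬p))
  incident⁺ (inj₂ refl) ¬p = inj₂ (sym (reroute-kept ¬p))

  incident-new : ∀ {e} → Incident zero (splitEnds (suc e)) → A e
  incident-new (inj₁ eq) = reroute-zero (sym eq)
  incident-new (inj₂ eq) = reroute-zero (sym eq)

  incident-zero : ∀ {s} → Incident (suc s) (splitEnds zero) → s ≡ t
  incident-zero (inj₂ refl) = refl

  farFrom⁻ : ∀ {s e v} → DD′.FarFrom (suc s) (suc e) v → FarFrom s e v × ¬ (s ≡ t × A e)
  farFrom⁻ (i , far) with i′ , ¬p ← incident⁻ i = (i′ , far ∘ connected-lift) , ¬p

  farFrom⁺ : ∀ {s e v} → FarFrom s e v → ¬ (s ≡ t × A e) → DD′.FarFrom (suc s) (suc e) v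
  farFrom⁺ (i , far) ¬p = incident⁺ i ¬p , far ∘ connected-contract

  boldEdges-kept : ∀ {s} → s ≢ t → length (DD′.boldEdges (suc s)) ≤ length (boldEdges s)
  boldEdges-kept {s} s≢t = pigeonhole (λ e′ e → e′ ≡ suc e) (boldEdges s)
    (unique-filter (λ e → D′.bold? e ×-dec incident? _≟ᶠ_ (suc s) (splitEnds e)) (allFin⁺ _))
    hit (λ { _ _ refl refl → refl })
    where
    hit : ∀ {e′} → e′ ∈ DD′.boldEdges (suc s) → ∃ λ e → e ∈ boldEdges s × e′ ≡ suc e
    hit {e′} e′∈ with ∈-filter⁻ (λ e → D′.bold? e ×-dec incident? _≟ᶠ_ (suc s) (splitEnds e)) {xs = allFin _} e′∈
    hit {zero}  _ | _ , _ , i = contradiction (incident-zero i) s≢t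
    hit {suc e} _ | _ , b , i = e , ∈-filter⁺ (λ e → bold? e ×-dec incident? _≟ᶠ_ s (T.ends e)) (∈-allFin e)
                                      (≤-trans b (∣adh∣-split e) , proj₁ (incident⁻ i)) , refl

  boldEdges-new : ∀ e → (∀ {e′} → A e′ → Bold e′ → e′ ≡ e) → length (DD′.boldEdges zero) ≤ 2
  boldEdges-new e sole = pigeonhole _≡_ (zero ∷ suc e ∷ [])
    (unique-filter (λ e → D′.bold? e ×-dec incident? _≟ᶠ_ zero (splitEnds e)) (allFin⁺ _))
    hit (λ { _ _ refl refl → refl })
    where
    hit : ∀ {e′} → e′ ∈ DD′.boldEdges zero → ∃ λ e″ → e″ ∈ zero ∷ suc e ∷ [] × e′ ≡ e″
    hit {e′} e′∈ with ∈-filter⁻ (λ e → D′.bold? e ×-dec incident? _≟ᶠ_ zero (splitEnds e)) {xs = allFin _} e′∈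
    hit {zero}   _ | _ = zero , here refl , refl
    hit {suc e′} _ | _ , b , i with refl ← sole (incident-new i) (≤-trans b (∣adh∣-split e′)) =
      suc e , there (here refl) , refl

-- Merging branches along a labelling

module Labelling (G : Graph) {L : Set} (_≟_ : DecidableEquality L) where
  open Graph G using (Vertex; order)

  is : L → L → Bool
  is l l′ = does (l′ ≟ l)

  is⁺ : ∀ {l l′} → l′ ≡ l → is l l′ ≡ true
  is⁺ {l} {l′} = dec-true (l′ ≟ l)

  is⁻ : ∀ {l l′} → is l l′ ≡ true → l′ ≡ l
  is⁻ {l} {l′} eq with l′ ≟ l
  ... | yes l′≡l = l′≡l
  is⁻ () | no _

  -- The degree of `l` in the multigraph obtained from `G` by identifying vertices with equal
  -- labels.
  cutAt : (Vertex → L) → L → ℕ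
  cutAt φ l = cut (is l ∘ φ) (edgeEnds G)

  cut-is≤degree : ∀ l (H : Multigraph L) → cut (is l) (edgeList H) ≤ Suppression.degree _≟_ H l
  cut-is≤degree l H = count-mono (differ? (is l)) (incident? _≟_ l) (edgeList H) λ {p} _ → differ⇒incident p
    where
    differ⇒incident : ∀ p → is l (proj₁ p) ≢ is l (proj₂ p) → Incident l p
    differ⇒incident (a , b) d with a ≟ l | b ≟ l
    ... | yes refl | _        = inj₁ refl
    ... | no _     | yes refl = inj₂ refl
    ... | no _     | no _     = contradiction refl d

  relabel : L → L → L → L
  relabel x y l = if does (l ≟ x) then y else l

  relabel-≡ : ∀ {x y l} → l ≡ x → relabel x y l ≡ y
  relabel-≡ {x} {y} {l} eq rewrite dec-true (l ≟ x) eq = refl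

  relabel-≢ : ∀ {x y l} → l ≢ x → relabel x y l ≡ l
  relabel-≢ {x} {y} {l} ≢ rewrite dec-false (l ≟ x) ≢ = refl

  -- Labels collect the branches at a node with bag X into groups.  Merging the
  -- labels of u and w stands for splitting the node along their two branches.
  data Reducible (k : ℕ) (X : Subset order) (φ : Vertex → L) : Set where
    done  : (ls : List L) → length ls ≤ k →
            (∀ {v} → v ∉ˢ X → 3 ≤ cutAt φ (φ v) → φ v ∈ ls) → Reducible k X φ
    merge : ∀ u w → u ∉ˢ X → w ∉ˢ X → φ u ≢ φ w → cutAt φ (φ u) ≤ 2 →
            cutAt (relabel (φ u) (φ w) ∘ φ) (φ w) ≤ k →
            Reducible k X (relabel (φ u) (φ w) ∘ φ) → Reducible k X φ

  module _ (D : TreeCutDecomposition G) (t : Graph.Vertex (TreeCutDecomposition.tree D)) where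
    open TreeCutDecomposition D
    open Decomposition D

    -- The labels of vertices outside the bag correspond one to one to the inhabited branches at
    -- `t`, and no vertex of the bag shares such a label.
    record Realises (φ : Vertex → L) : Set where
      field
        same-branch : ∀ {e u v} → FarFrom t e u → FarFrom t e v → φ u ≡ φ v
        same-label  : ∀ {e u v} → FarFrom t e u → φ u ≡ φ v → FarFrom t e v

      ∣adh∣≤cutAt : ∀ {e v} → FarFrom t e v → ∣ adh e ∣ ≤ cutAt φ (φ v)
      ∣adh∣≤cutAt {v = v} far = ∣adh∣≤cut (is (φ v) ∘ φ) (proj₁ far)
        (λ far′ → is⁺ (same-branch far′ far)) (λ eq → same-label far (sym (is⁻ eq)))

  Certified : ℕ → (D : TreeCutDecomposition G) → Graph.Vertex (TreeCutDecomposition.tree D) → Set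
  Certified k D t = ∃ λ φ → Realises D t φ × Reducible k (TreeCutDecomposition.bag D t) φ

  boldEdges≤ : ∀ {k} (D : TreeCutDecomposition G) t {φ} → Realises D t φ →
               (ls : List L) → length ls ≤ k →
               (∀ {v} → v ∉ˢ TreeCutDecomposition.bag D t → 3 ≤ cutAt φ (φ v) → φ v ∈ ls) →
               length (Decomposition.boldEdges D t) ≤ k
  boldEdges≤ D t {φ} real ls ls≤k complete = ≤-trans
    (pigeonhole (λ e l → ∃ λ v → FarFrom t e v × φ v ≡ l) ls
      (unique-filter (λ e → bold? e ×-dec incident? _≟ᶠ_ t (T.ends e)) (allFin⁺ T.size)) hit
      λ { _ _ (v , far , refl) (v′ , far′ , eq) →
          far-unique (proj₁ far) (proj₁ far′) (proj₂ (same-label far (sym eq))) (proj₂ far′) })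
    ls≤k
    where
    open TreeCutDecomposition D
    open Decomposition D
    open Realises real

    hit : ∀ {e} → e ∈ boldEdges t → ∃ λ l → l ∈ ls × ∃ λ v → FarFrom t e v × φ v ≡ l
    hit {e} e∈ with ∈-filter⁻ (λ e → bold? e ×-dec incident? _≟ᶠ_ t (T.ends e)) {xs = allFin T.size} e∈
    ... | _ , bold , i with any? (λ v → far? e t (nodeOf v))
    ...   | yes (v , far) = φ v , complete (λ v∈ → far-irrefl (subst (Far e t) (bag⇒nodeOf v∈) far))
                                    (≤-trans bold (∣adh∣≤cutAt (i , far))) , v , (i , far) , refl
    -- With no vertex beyond `e`, the indicator is constantly false and cuts nothing, so the
    -- adhesion is empty and `e` is not bold.
    ...   | no none = contradiction (≤-trans bold (≤-trans
              (∣adh∣≤cut (λ _ → false) i (λ far → contradiction (_ , proj₂ far) none) λ ())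
              (≤-reflexive (count-none (differ? (λ _ → false)) (edgeEnds G) λ _ d → d refl)))) λ ()

  -- `thin` keeps the edge towards `u` from being bold, so the new node has at most the new edge and
  -- the edge towards `w` as bold edges; `small` bounds the adhesion of the new edge.
  module Merge {k : ℕ} (3≤k : 3 ≤ k) (D : TreeCutDecomposition G)
               (t : Graph.Vertex (TreeCutDecomposition.tree D))
               (adh≤k : ∀ e → ∣ TreeCutDecomposition.adh D e ∣ ≤ k)
               {φ : Vertex → L} (real : Realises D t φ) (u w : Vertex)
               (u∉ : u ∉ˢ TreeCutDecomposition.bag D t) (w∉ : w ∉ˢ TreeCutDecomposition.bag D t)
               (φu≢φw : φ u ≢ φ w) (thin : cutAt φ (φ u) ≤ 2)
               (small : cutAt (relabel (φ u) (φ w) ∘ φ) (φ w) ≤ k) where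
    open TreeCutDecomposition D
    open Decomposition D
    open Realises real

    far-branch : ∀ {v} → v ∉ˢ bag t → ∃ λ e → FarFrom t e v
    far-branch v∉ = far-exists λ t≡ → v∉ (nodeOf⇒bag (sym t≡))

    eᵘ eʷ : T.Edge
    eᵘ = proj₁ (far-branch u∉)
    eʷ = proj₁ (far-branch w∉)

    farᵘ : FarFrom t eᵘ u
    farᵘ = proj₂ (far-branch u∉)

    farʷ : FarFrom t eʷ w
    farʷ = proj₂ (far-branch w∉)

    Merged : T.Edge → Set
    Merged e = e ≡ eᵘ ⊎ e ≡ eʷ

    merged? : Decidable Merged
    merged? e = (e ≟ᶠ eᵘ) ⊎-dec (e ≟ᶠ eʷ)

    merged⇒incident : ∀ {e} → Merged e → Incident t (T.ends e)
    merged⇒incident (inj₁ refl) = proj₁ farᵘ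
    merged⇒incident (inj₂ refl) = proj₁ farʷ

    open Split D t {Merged} merged? merged⇒incident public

    φ′ : Vertex → L
    φ′ = relabel (φ u) (φ w) ∘ φ

    merged⇒label : ∀ {e v} → Merged e → FarFrom t e v → φ′ v ≡ φ w
    merged⇒label (inj₁ refl) far = relabel-≡ (same-branch far farᵘ)
    merged⇒label (inj₂ refl) far = trans (relabel-≢ (λ eq → φu≢φw (trans (sym eq) (same-branch far farʷ))))
                                         (same-branch far farʷ)

    label⇒merged : ∀ {v} → φ′ v ≡ φ w → ∃ λ e → Merged e × FarFrom t e v
    label⇒merged {v} eq with φ v ≟ φ u
    ... | yes φv≡ = eᵘ , inj₁ refl , same-label farᵘ (sym φv≡)
    ... | no _    = eʷ , inj₂ refl , same-label farʷ (sym eq)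

    label-kept : ∀ {e v} → ¬ Merged e → FarFrom t e v → φ′ v ≡ φ v
    label-kept ¬m far = relabel-≢ λ eq →
      ¬m (inj₁ (far-unique (proj₁ far) (proj₁ farᵘ) (proj₂ far) (proj₂ (same-label farᵘ (sym eq)))))

    farFrom-zero⁻ : ∀ {v} → DD′.FarFrom (suc t) zero v → φ′ v ≡ φ w
    farFrom-zero⁻ (_ , far) with e , m , far′ ← far-zero⁻ far =
      merged⇒label m (merged⇒incident m , far′)

    farFrom-zero⁺ : ∀ {v} → φ′ v ≡ φ w → DD′.FarFrom (suc t) zero v
    farFrom-zero⁺ eq with e , m , far ← label⇒merged eq = inj₂ refl , far-zero⁺ m (proj₂ far)

    realises-merged : Realises splitDecomposition (suc t) φ′
    realises-merged = record { same-branch = same-branch′ ; same-label = same-label′ }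
      where
      same-branch′ : ∀ {e u v} → DD′.FarFrom (suc t) e u → DD′.FarFrom (suc t) e v → φ′ u ≡ φ′ v
      same-branch′ {zero}  fu fv = trans (farFrom-zero⁻ fu) (sym (farFrom-zero⁻ fv))
      same-branch′ {suc e} fu fv = cong (relabel _ _) (same-branch (proj₁ (farFrom⁻ fu)) (proj₁ (farFrom⁻ fv)))

      same-label′ : ∀ {e u v} → DD′.FarFrom (suc t) e u → φ′ u ≡ φ′ v → DD′.FarFrom (suc t) e v
      same-label′ {zero}  fu eq = farFrom-zero⁺ (trans (sym eq) (farFrom-zero⁻ fu))
      same-label′ {suc e} {a} {b} fu eq with far , ¬m ← farFrom⁻ fu =
        farFrom⁺ (same-label far (trans (sym (label-kept (¬m ∘ (refl ,_)) far)) (trans eq kept))) ¬m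
        where
        kept : φ′ b ≡ φ b
        -- If `b` had the label of `u`, then `φ′ a` would be `φ w`, which puts `a` beyond a merged
        -- edge; by uniqueness that edge is `e`, which is not merged.
        kept = relabel-≢ λ φb≡ → ¬m (refl , (let e′ , m , far′ = label⇒merged (trans eq (relabel-≡ φb≡)) in
          subst Merged (far-unique (proj₁ far′) (proj₁ far) (proj₂ far′) (proj₂ far)) m))

    realises-other : ∀ {s ψ} → s ≢ t → Realises D s ψ → Realises splitDecomposition (suc s) ψ
    realises-other {s} {ψ} s≢t r = record { same-branch = same-branch′ ; same-label = same-label′ }
      where
      same-branch′ : ∀ {e u v} → DD′.FarFrom (suc s) e u → DD′.FarFrom (suc s) e v → ψ u ≡ ψ v
      same-branch′ {zero}  fu fv = contradiction (incident-zero (proj₁ fu)) s≢t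
      same-branch′ {suc e} fu fv = Realises.same-branch r (proj₁ (farFrom⁻ fu)) (proj₁ (farFrom⁻ fv))

      same-label′ : ∀ {e u v} → DD′.FarFrom (suc s) e u → ψ u ≡ ψ v → DD′.FarFrom (suc s) e v
      same-label′ {zero}  fu eq = contradiction (incident-zero (proj₁ fu)) s≢t
      same-label′ {suc e} fu eq = farFrom⁺ (Realises.same-label r (proj₁ (farFrom⁻ fu)) eq) (s≢t ∘ proj₁)

    adh-merged≤k : ∀ e → ∣ D′.adh e ∣ ≤ k
    adh-merged≤k (suc e) = ≤-trans (∣adh∣-split e) (adh≤k e)
    adh-merged≤k zero    = ≤-trans
      (DD′.∣adh∣≤cut (is (φ w) ∘ φ′) (inj₂ refl) (is⁺ ∘ farFrom-zero⁻) (farFrom-zero⁺ ∘ is⁻)) small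

    boldEdges-new≤k : length (DD′.boldEdges zero) ≤ k
    boldEdges-new≤k = ≤-trans (boldEdges-new eʷ λ
      { (inj₁ refl) bold → contradiction (≤-trans (∣adh∣≤cutAt farᵘ) thin) (<⇒≱ bold)
      ; (inj₂ refl) _    → refl }) (≤-trans (n≤1+n 2) 3≤k)

  record Bounded (k : ℕ) (D : TreeCutDecomposition G) : Set where
    constructor bounded
    open TreeCutDecomposition D
    field
      adh≤ : ∀ e → ∣ adh e ∣ ≤ k
      bag≤ : ∀ t → ∣ bag t ∣ ≤ k

  FewBold : ℕ → (D : TreeCutDecomposition G) → Graph.Vertex (TreeCutDecomposition.tree D) → Set
  FewBold k D t = length (Decomposition.boldEdges D t) ≤ k

  FewBoldDecomposition : ℕ → Set
  FewBoldDecomposition k = Σ (TreeCutDecomposition G) λ D → Bounded k D × ∀ t → FewBold k D t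

  module _ {k : ℕ} (3≤k : 3 ≤ k) where

    -- `ts` lists the nodes still to be treated. A split renames all of them by `suc`, so the
    -- recursion runs on the bound `n` for their number and, inside `reduce`, on the sequence of
    -- merges.
    reduceAll : ∀ n (D : TreeCutDecomposition G) → Bounded k D → ∀ ts → length ts ≤ n → Unique ts →
                All (Certified k D) ts → (∀ s → FewBold k D s ⊎ s ∈ ts) → FewBoldDecomposition k

    reduce : ∀ n (D : TreeCutDecomposition G) → Bounded k D → ∀ t ts → length ts ≤ n → Unique (t ∷ ts) →
             ∀ {φ} → Realises D t φ → Reducible k (TreeCutDecomposition.bag D t) φ →
             All (Certified k D) ts → (∀ s → FewBold k D s ⊎ s ∈ t ∷ ts) → FewBoldDecomposition k

    reduceAll n D b [] _ _ _ few = D , b , λ s → [ id , (λ ()) ] (few s)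
    reduceAll (suc n) D b (t ∷ ts) l u ((φ , real , red) ∷ certs) few =
      reduce n D b t ts (s≤s⁻¹ l) u real red certs few

    reduce n D b t ts l (_ ∷ u) {φ} real (done ls ls≤k complete) certs few =
      reduceAll n D b ts l u certs few′
      where
      few′ : ∀ s → FewBold k D s ⊎ s ∈ ts
      few′ s with few s
      ... | inj₁ f            = inj₁ f
      ... | inj₂ (here refl)  = inj₁ (boldEdges≤ D t real ls ls≤k complete)
      ... | inj₂ (there s∈)   = inj₂ s∈
    reduce n D (bounded adh≤k bag≤k) t ts l (t∉ ∷ u) {φ} real (merge a b a∉ b∉ a≢b thin small red) certs few =
      reduce n splitDecomposition
        (bounded adh-merged≤k λ { zero → ≤-trans (≤-reflexive (∣⊥∣≡0 (Graph.order G))) z≤n ; (suc s) → bag≤k s })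
        (suc t) (map suc ts) (≤-trans (≤-reflexive (length-map suc ts)) l)
        (unique-map suc-injective (t∉ ∷ u)) realises-merged red
        (All.map⁺ (All.zipWith (λ { {s} (t≢s , ψ , r , c) → ψ , realises-other (t≢s ∘ sym) r , c }) (t∉ , certs)))
        few′
      where
      open Merge 3≤k D t adh≤k real a b a∉ b∉ a≢b thin small

      few′ : ∀ s → FewBold k splitDecomposition s ⊎ s ∈ map suc (t ∷ ts)
      -- The new node has few bold edges from the start and never enters the list.
      few′ zero = inj₁ boldEdges-new≤k
      few′ (suc s) = kept (s ≟ᶠ t) (few s)
        where
        kept : Dec (s ≡ t) → FewBold k D s ⊎ s ∈ t ∷ ts →
               FewBold k splitDecomposition (suc s) ⊎ suc s ∈ map suc (t ∷ ts)
        kept (yes refl) _         = inj₂ (here refl)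
        kept (no s≢t)   (inj₁ f)  = inj₁ (≤-trans (boldEdges-kept s≢t) f)
        kept (no s≢t)   (inj₂ s∈) = inj₂ (∈-map⁺ suc s∈)

-- From the 3-center to a sequence of merges

module Contraction {G : Graph} {L : Set} (_≟_ : DecidableEquality L)
                   {Protected : L → Set} (protected? : ∀ l → Dec (Protected l))
                   (k : ℕ) (X : Subset (Graph.order G)) where
  open Graph G using (Vertex; order)
  open Labelling G _≟_
  open Suppression _≟_
  open SuppressionProperties _≟_
  open DecMembership _≟_ using (_∈?_)

  -- H dominates the graph obtained from G by identifying vertices with equal labels.
  record Dominates (H : Multigraph L) (φ : Vertex → L) : Set where
    field
      wellFormed  : WellFormed H
      dominated   : ∀ Q → (∀ {l} → Q l ≡ true → l ∈ vertexList H × ¬ Protected l) →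
                    cut (Q ∘ φ) (edgeEnds G) ≤ cut Q (edgeList H)
      dead        : ∀ {v} → φ v ∉ vertexList H → cutAt φ (φ v) ≤ 2
      inhabited   : ∀ {l} → l ∈ vertexList H → ∃ λ v → φ v ≡ l
      degree≤     : ∀ {l} → l ∈ vertexList H → ¬ Protected l → degree H l ≤ k
      bag⇒        : ∀ {v} → v ∈ˢ X → Protected (φ v)
      protected⇒  : ∀ {v} → Protected (φ v) → v ∈ˢ X

    cutAt≤degree : ∀ {l} → l ∈ vertexList H → ¬ Protected l → cutAt φ l ≤ degree H l
    cutAt≤degree {l} l∈ ¬p = ≤-trans
      (dominated (is l) (λ eq → subst (λ l → l ∈ vertexList H × ¬ Protected l) (sym (is⁻ eq)) (l∈ , ¬p)))
      (cut-is≤degree l H)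

  module _ {H : Multigraph L} {φ : Vertex → L} (dom : Dominates H φ)
           {x : L} (x∈ : x ∈ vertexList H) (d≤2 : degree H x ≤ 2) (¬px : ¬ Protected x) where
    open Dominates dom

    private
      H′ = suppress H x

    -- Here the label `x` dies unmerged. An admissible `Q` is false on dead and on protected labels,
    -- hence at `x` and at all its neighbours, which is the agreement that `suppress-cut` asks for.
    suppress-isolated : (∀ {y} → y ∈ neighbours H x → Protected y) → Dominates H′ φ
    suppress-isolated protected = record
      { wellFormed = suppress-wellFormed wellFormed d≤2
      ; dominated  = λ Q live → ≤-trans
          (dominated Q λ eq → let l∈ , ¬p = live eq in proj₁ (∈-suppress⁻ l∈) , ¬p)
          (suppress-cut wellFormed d≤2 Q (side Q live))
      ; dead       = dead′
      ; inhabited  = inhabited ∘ proj₁ ∘ ∈-suppress⁻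
      ; degree≤    = λ l∈ ¬p → ≤-trans (suppress-degree wellFormed d≤2 _) (degree≤ (proj₁ (∈-suppress⁻ l∈)) ¬p)
      ; bag⇒       = bag⇒
      ; protected⇒ = protected⇒
      }
      where
      side : (Q : L → Bool) → (∀ {l} → Q l ≡ true → l ∈ vertexList H′ × ¬ Protected l) →
             neighbours H x ≡ [] ⊎ (∃ λ y → y ∈ neighbours H x × Q x ≡ Q y)
      side Q live = first (neighbours H x) protected
        where
        same : ∀ {y} → Protected y → Q x ≡ Q y
        same {y} py with Q x in eqx | Q y in eqy
        ... | true  | _     = contradiction refl (proj₂ (∈-suppress⁻ {H} (proj₁ (live eqx))))
        ... | false | true  = contradiction py (proj₂ (live eqy))
        ... | false | false = refl

        first : ∀ ys → (∀ {y} → y ∈ ys → Protected y) → ys ≡ [] ⊎ (∃ λ y → y ∈ ys × Q x ≡ Q y)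
        first []      _  = inj₁ refl
        first (y ∷ _) py = inj₂ (y , here refl , same (py (here refl)))

      dead′ : ∀ {v} → φ v ∉ vertexList H′ → cutAt φ (φ v) ≤ 2
      dead′ {v} ∉H′ with φ v ≟ x
      ... | yes refl = ≤-trans (cutAt≤degree x∈ ¬px) d≤2
      ... | no  φv≢x = dead λ ∈H → ∉H′ (∈-suppress⁺ ∈H φv≢x)

    module _ {y : L} (y∈ : y ∈ neighbours H x) (¬py : ¬ Protected y) where

      private
        ρ  = relabel x y
        y≢x = neighbour≢ {H} wellFormed y∈

        y∈H : y ∈ vertexList H
        y∈H = proj₁ (neighbour⁻ {H} y∈)

        y∈H′ : y ∈ vertexList H′
        y∈H′ = ∈-suppress⁺ y∈H y≢x

      -- Pulling `Q` back along `ρ` puts `x` and `y` on the same side, as `suppress-cut` requires;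
      -- on the labels still live `ρ` is the identity, so the cut of the suppressed multigraph is
      -- that of `Q`.
      suppress-merged : Dominates H′ (ρ ∘ φ)
      suppress-merged = record
        { wellFormed = wf′
        ; dominated  = λ Q live → ≤-trans (dominated (Q ∘ ρ) (live-ρ Q live))
            (≤-trans (suppress-cut wellFormed d≤2 (Q ∘ ρ)
                       (inj₂ (y , y∈ , cong Q (trans (relabel-≡ refl) (sym (relabel-≢ y≢x))))))
                     (count-mono (differ? (Q ∘ ρ)) (differ? Q) (edgeList H′) λ p∈ d eq →
                       let a∈ , b∈ , _ = proj₂ wf′ p∈ in
                       d (trans (cong Q (ρ-live a∈)) (trans eq (sym (cong Q (ρ-live b∈)))))))
        ; dead       = dead′
        ; inhabited  = λ l∈ → let v , eq = inhabited (proj₁ (∈-suppress⁻ l∈)) in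
                              v , trans (cong ρ eq) (ρ-live l∈)
        ; degree≤    = λ l∈ ¬p → ≤-trans (suppress-degree wellFormed d≤2 _) (degree≤ (proj₁ (∈-suppress⁻ l∈)) ¬p)
        ; bag⇒       = λ v∈ → subst Protected (sym (relabel-≢ λ { refl → ¬px (bag⇒ v∈) })) (bag⇒ v∈)
        ; protected⇒ = protected⇒′
        }
        where
        wf′ = suppress-wellFormed wellFormed d≤2

        ρ-live : ∀ {l} → l ∈ vertexList H′ → ρ l ≡ l
        ρ-live l∈ = relabel-≢ (proj₂ (∈-suppress⁻ {H} l∈))

        live-ρ : (Q : L → Bool) → (∀ {l} → Q l ≡ true → l ∈ vertexList H′ × ¬ Protected l) →
                 ∀ {l} → Q (ρ l) ≡ true → l ∈ vertexList H × ¬ Protected l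
        live-ρ Q live {l} eq with l ≟ x
        ... | yes refl = x∈ , ¬px
        ... | no _ with l∈ , ¬p ← live eq = proj₁ (∈-suppress⁻ l∈) , ¬p

        protected⇒′ : ∀ {v} → Protected (ρ (φ v)) → v ∈ˢ X
        protected⇒′ {v} p with φ v ≟ x
        ... | yes _ = contradiction p ¬py
        ... | no _  = protected⇒ p

        dead′ : ∀ {v} → ρ (φ v) ∉ vertexList H′ → cutAt (ρ ∘ φ) (ρ (φ v)) ≤ 2
        dead′ {v} ∉H′ = ≤-trans (count-mono (differ? (is (ρ (φ v)) ∘ ρ ∘ φ)) (differ? (is (φ v) ∘ φ)) (edgeEnds G)
                                    λ _ d eq → d (trans (unmoved _) (trans eq (sym (unmoved _)))))
                                  (dead λ ∈H → ∉H′ (subst (_∈ vertexList H′) (sym (relabel-≢ φv≢x)) (∈-suppress⁺ ∈H φv≢x)))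
          where
          φv≢x : φ v ≢ x
          φv≢x eq = ∉H′ (subst (_∈ vertexList H′) (sym (relabel-≡ eq)) y∈H′)

          φv≢y : φ v ≢ y
          φv≢y eq = ∉H′ (subst (_∈ vertexList H′) (sym (trans (relabel-≢ φv≢x) eq)) y∈H′)

          -- A dead label is neither `x` nor `y`, so the set of vertices carrying it is the same
          -- before and after the merge.
          unmoved : ∀ u → is (ρ (φ v)) (ρ (φ u)) ≡ is (φ v) (φ u)
          unmoved u rewrite relabel-≢ {x} {y} φv≢x with φ u ≟ x
          ... | no _     = refl
          ... | yes refl = trans (dec-false (y ≟ φ v) (φv≢y ∘ sym)) (sym (dec-false (φ u ≟ φ v) (φv≢x ∘ sym)))

  dominates⇒done : ∀ {H φ} → Dominates H φ → length (vertexList H) ≤ k → Reducible k X φ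
  dominates⇒done {H} {φ} dom V≤k = done (vertexList H) V≤k λ {v} _ bold →
    decidable-stable (φ v ∈? vertexList H) λ ∉H → <⇒≱ bold (Dominates.dead dom ∉H)

  -- The recursion is that of `suppressWithin`, so the bound on the final multigraph passes
  -- unchanged through every round.
  dominates⇒reducible : ∀ n {H φ} → Dominates H φ → length (vertexList H) ≤ n →
                        length (vertexList (suppressWithin protected? n H)) ≤ k → Reducible k X φ
  dominates⇒reducible zero    dom _   V≤k = dominates⇒done dom V≤k
  dominates⇒reducible (suc n) {H} {φ} dom V≤n V≤k with suppressible protected? H in eq
  ... | [] = dominates⇒done dom V≤k
  ... | x ∷ _ with x∈ , d≤2 , ¬px ← suppressible⁻ protected? {H} (subst (x ∈_) (sym eq) (here refl))
              with Any.any? (λ y → ¬? (protected? y)) (neighbours H x)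
  ...   | no none = dominates⇒reducible n
            (suppress-isolated dom x∈ d≤2 ¬px λ {y} y∈ → decidable-stable (protected? y) λ ¬p → none (lose y∈ ¬p))
            (s≤s⁻¹ (≤-trans (length-suppress x∈) V≤n)) V≤k
  ...   | yes some with y , y∈ , ¬py ← find some
                   -- The two labels are exchanged for vertices of `G` carrying them, since merges
                   -- are recorded by vertices.
                   with u , refl ← Dominates.inhabited dom x∈
                   with w , refl ← Dominates.inhabited dom (proj₁ (neighbour⁻ {H} y∈)) =
    merge u w (¬px ∘ Dominates.bag⇒ dom) (¬py ∘ Dominates.bag⇒ dom) (neighbour≢ {H} wf y∈ ∘ sym)
      (≤-trans (Dominates.cutAt≤degree dom x∈ ¬px) d≤2)
      (≤-trans (Dominates.cutAt≤degree dom′ w∈ ¬py) (Dominates.degree≤ dom′ w∈ ¬py))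
      (dominates⇒reducible n dom′ (s≤s⁻¹ (≤-trans (length-suppress x∈) V≤n)) V≤k)
    where
    wf   = Dominates.wellFormed dom
    dom′ = suppress-merged dom x∈ d≤2 ¬px y∈ ¬py
    w∈   : φ w ∈ vertexList (suppress H (φ u))
    w∈   = ∈-suppress⁺ (proj₁ (neighbour⁻ {H} y∈)) (neighbour≢ {H} wf y∈)

-- Torsos and the bound ℓ ≤ k²

module Torso {G : Graph} (D : TreeCutDecomposition G) where
  open Graph G using (Vertex; Edge; order; size; ends; loopless)
  open TreeCutDecomposition D
  open Decomposition D
  open Labelling G _≟ˢ_
  open Suppression _≟ˢ_
  open SuppressionProperties _≟ˢ_

  ∈-torso⁺ : ∀ t v → class t v ∈ vertexList (torso t)
  ∈-torso⁺ t v = ∈-deduplicate⁺ _≟ˢ_ (∈-map⁺ (class t) (∈-allFin v))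

  ∈-torso⁻ : ∀ {t C} → C ∈ vertexList (torso t) → ∃ λ v → C ≡ class t v
  ∈-torso⁻ {t} C∈ with ∈-map⁻ (class t) (∈-deduplicate⁻ _≟ˢ_ (map (class t) (allFin order)) C∈)
  ... | v , _ , eq = v , eq

  torso-wellFormed : ∀ t → WellFormed (torso t)
  torso-wellFormed t = deduplicate-! _≟ˢ_ (map (class t) (allFin order)) , wf
    where
    wf : ∀ {p} → p ∈ edgeList (torso t) →
         proj₁ p ∈ vertexList (torso t) × proj₂ p ∈ vertexList (torso t) × proj₁ p ≢ proj₂ p
    wf p∈ with f , f∈ , refl ← ∈-map⁻ (classes t) p∈ =
      ∈-torso⁺ t _ , ∈-torso⁺ t _ ,
      proj₂ (∈-filter⁻ (inequivalent? t) {xs = allFin size} f∈) ∘ class⇒equiv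

  outside⇒far : ∀ {t v} → ¬ InBag t (class t v) → ∃ λ e → FarFrom t e v
  outside⇒far out = far-exists λ t≡ → out (nodeOf⇒inBag (sym t≡))

  -- At the start every class is live, so `dead` holds vacuously; a class outside the bag has degree
  -- at most the adhesion of the edge towards it.
  torso-dominates : ∀ {k} t → (∀ e → ∣ adh e ∣ ≤ k) →
                    Contraction.Dominates {G} _≟ˢ_ (inBag? t) k (bag t) (torso t) (class t)
  torso-dominates t adh≤k = record
    { wellFormed = torso-wellFormed t
    ; dominated  = λ Q _ → torso-cut t Q
    ; dead       = λ {v} ∉H → contradiction (∈-torso⁺ t v) ∉H
    ; inhabited  = λ l∈ → let v , eq = ∈-torso⁻ l∈ in v , sym eq
    ; degree≤    = degree≤
    ; bag⇒       = λ v∈ → nodeOf⇒inBag (bag⇒nodeOf v∈)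
    ; protected⇒ = λ p → nodeOf⇒bag (inBag⇒nodeOf p)
    }
    where
    degree≤ : ∀ {C} → C ∈ vertexList (torso t) → ¬ InBag t C → degree (torso t) C ≤ _
    degree≤ C∈ out with v , refl ← ∈-torso⁻ C∈ with e , far ← outside⇒far out =
      ≤-trans (torso-degree far) (adh≤k e)

  class-realises : ∀ t → Realises D t (class t)
  class-realises t = record
    { same-branch = λ far far′ → equiv⇒class (far-equiv far far′)
    ; same-label  = λ far eq → equiv-far (class⇒equiv eq) far
    }

  bagVertices : T.Vertex → List Vertex
  bagVertices t = filter (_∈ˢ? bag t) (allFin order)

  -- Vertices of the bag are protected from suppression and form distinct singleton classes.
  ∣bag∣≤∣threeCenter∣ : ∀ t → ∣ bag t ∣ ≤ length (vertexList (threeCenter t))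
  ∣bag∣≤∣threeCenter∣ t = ≤-trans (≤-reflexive (∣∣≡length (bag t)))
    (pigeonhole (λ v C → C ≡ class t v) (vertexList (threeCenter t))
      (unique-filter (_∈ˢ? bag t) (allFin⁺ order))
      (λ v∈ → _ , survives (proj₂ (∈-filter⁻ (_∈ˢ? bag t) {xs = allFin order} v∈)) , refl)
      λ { v∈ _ refl eq → equiv-bag (inj₁ (bag⇒nodeOf (proj₂ (∈-filter⁻ (_∈ˢ? bag t) {xs = allFin order} v∈))))
                                    (class⇒equiv eq) })
    where
    survives : ∀ {v} → v ∈ˢ bag t → class t v ∈ vertexList (threeCenter t)
    survives {v} v∈ = proj₁ (suppressWithin-induction (inBag? t) (λ H → class t v ∈ vertexList H)
      (λ x∈ _ ¬p C∈ → ∈-suppress⁺ C∈ λ { refl → ¬p (nodeOf⇒inBag (bag⇒nodeOf v∈)) })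
      _ ≤-refl (∈-torso⁺ t v))

  certified : ∀ {k} t → (∀ e → ∣ adh e ∣ ≤ k) → length (vertexList (threeCenter t)) ≤ k → Certified k D t
  certified {k} t adh≤k V≤k = class t , class-realises t ,
    Contraction.dominates⇒reducible {G} _≟ˢ_ (inBag? t) k (bag t) _ (torso-dominates t adh≤k) ≤-refl V≤k

  adhesionWidth≤ : ∀ {k} → (∀ e → ∣ adh e ∣ ≤ k) → (∀ t → length (boldEdges t) ≤ k) → adhesionWidth ≤ k * k
  adhesionWidth≤ {k} adh≤k few = maxOver-least T.order _ λ t →
    ≤-trans (∣⋃∣≤ (boldEdges t) adh≤k) (*-monoˡ-≤ k (few t))

  adh≤wollanWidth : ∀ e → ∣ adh e ∣ ≤ wollanWidth
  adh≤wollanWidth e = ≤-trans (maxOver-upper T.size _ e) (m≤m⊔n _ _)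

  threeCenter≤wollanWidth : ∀ t → length (vertexList (threeCenter t)) ≤ wollanWidth
  threeCenter≤wollanWidth t = ≤-trans (maxOver-upper T.order (λ t → length (vertexList (threeCenter t))) t)
                                      (m≤n⊔m (maxOver T.size (λ e → ∣ adh e ∣)) _)

  bounded-wollanWidth : Bounded wollanWidth D
  bounded-wollanWidth = bounded adh≤wollanWidth λ t → ≤-trans (∣bag∣≤∣threeCenter∣ t) (threeCenter≤wollanWidth t)

  fewBold : FewBoldDecomposition wollanWidth
  fewBold with 3 ≤? wollanWidth
  ... | yes 3≤k = reduceAll 3≤k _ D bounded-wollanWidth (allFin T.order) ≤-refl (allFin⁺ T.order)
        (All.tabulate λ {t} _ → certified t adh≤wollanWidth (threeCenter≤wollanWidth t)) (λ s → inj₂ (∈-allFin s))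
  -- All adhesions are below 3, so no edge is bold and `D` itself serves.
  ... | no k<3 = D , bounded-wollanWidth ,
        λ t → ≤-trans (≤-reflexive (count-none (λ e → bold? e ×-dec incident? _≟ᶠ_ t (T.ends e)) (allFin T.size)
          λ { {e} _ (bold , _) → k<3 (≤-trans bold (adh≤wollanWidth e)) })) z≤n

abWidth≤wollanWidth² : ∀ {G} (D : TreeCutDecomposition G) → let k = TreeCutDecomposition.wollanWidth D in
  Σ (TreeCutDecomposition G) λ D′ →
    TreeCutDecomposition.adhesionWidth D′ ≤ k * k × TreeCutDecomposition.bagWidth D′ ≤ k * k
abWidth≤wollanWidth² D with Torso.fewBold D
... | D′ , b , few = D′ , Torso.adhesionWidth≤ D′ (Labelling.Bounded.adh≤ b) few ,
                     maxOver-least _ _ λ t → ≤-trans (Labelling.Bounded.bag≤ b t) (n≤n*n _)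
  where
  n≤n*n : ∀ n → n ≤ n * n
  n≤n*n zero    = z≤n
  n≤n*n (suc n) = m≤m*n (suc n) (suc n)

-- Bounding the 3-center

module SameDecomposition {G : Graph} (D : TreeCutDecomposition G) where
  open Graph G using (Vertex; Edge; order; size; ends)
  open TreeCutDecomposition D
  open Decomposition D
  open Torso D
  open Suppression _≟ˢ_
  open SuppressionProperties _≟ˢ_

  adh⊆adhNode : ∀ {t e f} → Bold e → Incident t (T.ends e) → f ∈ˢ adh e → f ∈ˢ adhNode t
  adh⊆adhNode {t} {e} bold i = ∈-⋃⁺
    (∈-filter⁺ (λ e → bold? e ×-dec incident? _≟ᶠ_ t (T.ends e)) (∈-allFin e) (bold , i))

  -- The adhesion-width ignores thin edges, while Wollan's width counts every edge. Their adhesion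
  -- of at most 2 is the origin of the summand 2 in `wollanWidth≤`, and so of the 1 subtracted from
  -- k/2.
  ∣adh∣≤ : ∀ e → ∣ adh e ∣ ≤ 2 ⊔ adhesionWidth
  ∣adh∣≤ e with bold? e
  ... | no thin  = ≤-trans (s≤s⁻¹ (≰⇒> thin)) (m≤m⊔n 2 adhesionWidth)
  ... | yes bold = ≤-trans (p⊆q⇒∣p∣≤∣q∣ (adh⊆adhNode bold (inj₁ refl)))
                     (≤-trans (maxOver-upper T.order (λ t → ∣ adhNode t ∣) _) (m≤n⊔m 2 adhesionWidth))

  record Survives (t : T.Vertex) (H : Multigraph (Subset order)) : Set where
    field
      wellFormed : WellFormed H
      ⊆torso     : ∀ {C} → C ∈ vertexList H → C ∈ vertexList (torso t)
      degree≤    : ∀ C → degree H C ≤ degree (torso t) C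

  threeCenter-survives : ∀ t → Survives t (threeCenter t) ×
    (∀ {C} → C ∈ vertexList (threeCenter t) → ¬ InBag t C → 3 ≤ degree (threeCenter t) C)
  threeCenter-survives t = suppressWithin-induction (inBag? t) (Survives t)
    (λ _ d≤2 _ s → let open Survives s in record
      { wellFormed = suppress-wellFormed wellFormed d≤2
      ; ⊆torso     = ⊆torso ∘ proj₁ ∘ ∈-suppress⁻
      ; degree≤    = λ C → ≤-trans (suppress-degree wellFormed d≤2 C) (degree≤ C)
      })
    _ ≤-refl
    record { wellFormed = torso-wellFormed t ; ⊆torso = id ; degree≤ = λ _ → ≤-refl }

  adhEdges : T.Vertex → List Edge
  adhEdges t = filter (_∈ˢ? adhNode t) (allFin size)

  -- A class outside the bag survives only with degree at least 3; then the
  -- tree edge towards it is bold.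
  survivor-degree : ∀ {t C} → C ∈ vertexList (threeCenter t) → ¬ InBag t C →
                    3 ≤ count (incident? _≟ˢ_ C) (map (classes t) (adhEdges t))
  survivor-degree {t} C∈ out with s , 3≤ ← threeCenter-survives t
    with v , refl ← ∈-torso⁻ (Survives.⊆torso s C∈)
    with e , far ← outside⇒far out = ≤-trans 3≤d (begin
      degree (torso t) (class t v)
        ≡⟨ torso-degree-count t (class t v) ⟩
      count (λ f → incident? _≟ˢ_ (class t v) (classes t f) ×-dec inequivalent? t f) (allFin size)
        ≤⟨ count-mono _ (λ f → incident? _≟ˢ_ (class t v) (classes t f) ×-dec (f ∈ˢ? adhNode t)) (allFin size)
             (λ { _ (inc , ≁) → inc , adh⊆adhNode (≤-trans 3≤d (torso-degree far)) (proj₁ far)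
                    (∈-comprehension⁺ (separates? e) (torso-incident far ≁ inc)) }) ⟩
      count (λ f → incident? _≟ˢ_ (class t v) (classes t f) ×-dec (f ∈ˢ? adhNode t)) (allFin size)
        ≡⟨ count-filter (incident? _≟ˢ_ (class t v) ∘ classes t) (_∈ˢ? adhNode t) (allFin size) ⟨
      count (incident? _≟ˢ_ (class t v) ∘ classes t) (adhEdges t)
        ≡⟨ count-map (incident? _≟ˢ_ (class t v)) (classes t) (adhEdges t) ⟨
      count (incident? _≟ˢ_ (class t v)) (map (classes t) (adhEdges t)) ∎)
    where
    open ≤-Reasoning
    3≤d : 3 ≤ degree (torso t) (class t v)
    3≤d = ≤-trans (3≤ C∈ out) (Survives.degree≤ s _)

  survivors≤ : ∀ t → count (¬? ∘ inBag? t) (vertexList (threeCenter t)) ≤ ∣ adhNode t ∣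
  survivors≤ t = *-cancelʳ-≤ _ _ 2 (begin
    -- The handshake gives the factor 2/3; it is relaxed to 1, which suffices because bag and
    -- survivors may contribute ℓ each.
    length survivors * 2 ≤⟨ *-monoʳ-≤ (length survivors) (n≤1+n 2) ⟩
    length survivors * 3 ≤⟨ handshake _≟ˢ_ (map (classes t) (adhEdges t)) (unique-filter (¬? ∘ inBag? t) unique)
                              (λ C∈ → let C∈V , out = ∈-filter⁻ (¬? ∘ inBag? t) {xs = vertexList (threeCenter t)} C∈
                                      in survivor-degree C∈V out) ⟩
    length (map (classes t) (adhEdges t)) * 2
      ≡⟨ cong (_* 2) (trans (length-map (classes t) (adhEdges t)) (sym (∣∣≡length (adhNode t)))) ⟩
    ∣ adhNode t ∣ * 2 ∎)
    where
    open ≤-Reasoning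
    survivors = filter (¬? ∘ inBag? t) (vertexList (threeCenter t))
    unique    = proj₁ (Survives.wellFormed (proj₁ (threeCenter-survives t)))

  bagClasses≤ : ∀ t → count (inBag? t) (vertexList (threeCenter t)) ≤ ∣ bag t ∣
  bagClasses≤ t = ≤-trans
    (pigeonhole (λ C v → C ≡ class t v) (bagVertices t)
      (unique-filter (inBag? t) (proj₁ (Survives.wellFormed (proj₁ (threeCenter-survives t)))))
      (λ C∈ → let v , v∈ , eq = proj₂ (∈-filter⁻ (inBag? t) {xs = vertexList (threeCenter t)} C∈)
              in v , ∈-filter⁺ (_∈ˢ? bag t) (∈-allFin v) v∈ , eq)
      λ { _ _ refl eq → sym eq })
    (≤-reflexive (sym (∣∣≡length (bag t))))

  threeCenter≤ : ∀ t → length (vertexList (threeCenter t)) ≤ bagWidth + adhesionWidth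
  threeCenter≤ t = ≤-trans (≤-reflexive (length-split (inBag? t) (vertexList (threeCenter t)))) (+-mono-≤
    (≤-trans (bagClasses≤ t) (maxOver-upper T.order (λ t → ∣ bag t ∣) t))
    (≤-trans (survivors≤ t) (maxOver-upper T.order (λ t → ∣ adhNode t ∣) t)))

  wollanWidth≤ : ∀ {ℓ} → adhesionWidth ≤ ℓ → bagWidth ≤ ℓ → wollanWidth ≤ ℓ + ℓ + 2
  wollanWidth≤ {ℓ} a≤ℓ b≤ℓ = ⊔-lub
    (maxOver-least T.size _ λ e → ≤-trans (∣adh∣≤ e) (⊔-lub (m≤n+m 2 (ℓ + ℓ))
      (≤-trans a≤ℓ (≤-trans (m≤m+n ℓ ℓ) (m≤m+n (ℓ + ℓ) 2)))))
    (maxOver-least T.order _ λ t → ≤-trans (threeCenter≤ t) (≤-trans (+-mono-≤ b≤ℓ a≤ℓ) (m≤m+n (ℓ + ℓ) 2)))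

-- Rational arithmetic and the conclusion

half-1≤ : ∀ k ℓ → k ≤ ℓ + ℓ + 2 → ((+ k) / 2) - 1ℚ ≤ℚ (+ ℓ) / 1
half-1≤ k ℓ k≤ = ℚ.toℚᵘ-cancel-≤ (begin
  toℚᵘ (((+ k) / 2) - 1ℚ)            ≃⟨ ℚ.toℚᵘ-homo-+ ((+ k) / 2) (-ℚ 1ℚ) ⟩
  toℚᵘ ((+ k) / 2) ℚᵘ.+ toℚᵘ (-ℚ 1ℚ) ≃⟨ ℚᵘ.+-congˡ _ (ℚ.toℚᵘ-fromℚᵘ (mkℚᵘ (+ k) 1)) ⟩
  mkℚᵘ (+ k) 1 ℚᵘ.+ toℚᵘ (-ℚ 1ℚ)     ≤⟨ *≤* integers ⟩
  mkℚᵘ (+ ℓ) 0                       ≃⟨ ℚ.toℚᵘ-fromℚᵘ (mkℚᵘ (+ ℓ) 0) ⟨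
  toℚᵘ ((+ ℓ) / 1)                   ∎)
  where
  open ℚᵘ.≤-Reasoning
  -- The inequality k/2 - 1/1 ≤ ℓ/1 after multiplying out the denominators, in the form to which
  -- unnormalised rationals unfold.
  integers : ((+ k) ℤ.* (+ 1) ℤ.+ ℤ.-[1+ 0 ] ℤ.* (+ 2)) ℤ.* (+ 1) ℤ.≤ (+ ℓ) ℤ.* (+ 2)
  integers rewrite ℤ.*-identityʳ (+ k) | ℤ.*-identityʳ ((+ k) ℤ.+ ℤ.-[1+ 1 ]) | sym (ℤ.pos-* ℓ 2) =
    ℤ.≤-trans (ℤ.+-monoˡ-≤ ℤ.-[1+ 1 ] (ℤ.+≤+ k≤)) (ℤ.≤-reflexive
      (trans (ℤ.+-assoc (+ (ℓ + ℓ)) (+ 2) ℤ.-[1+ 1 ])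
        (trans (ℤ.+-identityʳ (+ (ℓ + ℓ)))
          (cong (λ n → + n) (trans (cong (λ n → ℓ + n) (sym (+-identityʳ ℓ))) (*-comm 2 ℓ))))))

corollary3p5 : (G : Graph) (k ℓ : ℕ) →
    IsWollanTreeCutWidth G k → IsAbTreeCutWidth G ℓ →
    (((+ k) / 2) - 1ℚ ≤ℚ (+ ℓ) / 1) × (ℓ ≤ k ^ 2)
corollary3p5 G k ℓ ((D , refl) , k-least) ((D′ , adh≤ℓ , bag≤ℓ) , ℓ-least) =
  half-1≤ k ℓ (≤-trans (k-least _ (D′ , refl)) (SameDecomposition.wollanWidth≤ D′ adh≤ℓ bag≤ℓ)) ,
  -- `k ^ 2` unfolds to `k * (k * 1)`.
  ≤-trans (ℓ-least _ (abWidth≤wollanWidth² D)) (≤-reflexive (cong (k *_) (sym (*-identityʳ k))))
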